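{- Let $\mathcal{F} \subseteq 2^{[n]}$ be an intersecting $B$-free family with $2 \le |F| \le n/2$ for all $F \in \mathcal{F}$. Then \[ \sum_{F\in\mathcal{F}}\frac{1}{\binom{n-1}{|F|-1}}\le 2. \]
   Context: $[n]=\{1,\dots,n\}$. A family is intersecting if any two of its members have nonempty intersection. The butterfly poset $B$ has four elements $w,x,y,z$ with relations $w,x\le y,z$. A family $\mathcal{F}$ is $B$-free if there are no four distinct sets $A_1,A_2,A_3,A_4\in\mathcal{F}$ with $A_1,A_2\subseteq A_3$ and $A_1,A_2\subseteq A_4$. -}

module Defs where

open import Data.Nat using (ℕ; zero; suc; _∸_)
open import Data.Nat.Combinatorics using (_C_)
open import Data.Integer using (+_)
open import Data.Rational using (ℚ; 0ℚ; _/_; _+_)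
open import Data.List using (List; foldr)
open import Data.List.Membership.Propositional using (_∈_)
open import Data.Fin.Subset using (Subset; _⊆_; _∩_; Nonempty; ∣_∣)
open import Data.Product using (_×_)
open import Relation.Binary.PropositionalEquality using (_≢_)
open import Relation.Nullary using (¬_)

-- Reciprocal of a natural number as a rational, with the convention 1/0 := 0.
-- (Only applied to positive binomial coefficients under the theorem's hypotheses.)
recip : ℕ → ℚ
recip zero    = 0ℚ
recip (suc m) = + 1 / suc m

-- A family of subsets of [n], represented as a list (assumed duplicate-free
-- in the statement).
Family : ℕ → Set
Family n = List (Subset n)

Intersecting : ∀ {n} → Family n → Set
Intersecting {n} 𝓕 = ∀ {A B : Subset n} → A ∈ 𝓕 → B ∈ 𝓕 → Nonempty (A ∩ B)

ButterflyFree : ∀ {n} → Family n → Set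
ButterflyFree {n} 𝓕 = ∀ {A₁ A₂ A₃ A₄ : Subset n} →
  A₁ ∈ 𝓕 → A₂ ∈ 𝓕 → A₃ ∈ 𝓕 → A₄ ∈ 𝓕 →
  A₁ ≢ A₂ → A₁ ≢ A₃ → A₁ ≢ A₄ → A₂ ≢ A₃ → A₂ ≢ A₄ → A₃ ≢ A₄ →
  ¬ ((A₁ ⊆ A₃ × A₂ ⊆ A₃) × (A₁ ⊆ A₄ × A₂ ⊆ A₄))

weight : ∀ {n} → Subset n → ℚ
weight {n} F = recip ((n ∸ 1) C (∣ F ∣ ∸ 1))

weightSum : ∀ {n} → Family n → ℚ
weightSum = foldr (λ F s → weight F + s) 0ℚ

{-# OPTIONS --safe #-}
module Submission where

-- Katona's cycle method. Sum over all cyclic orders σ of [n] and over the members F of 𝓕 that are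
-- arcs of σ, giving F the weight 1/|F|: in total F contributes in proportion to 1/C(n-1,|F|-1),
-- and intersecting antichains of arcs with at most n/2 elements have weight at most 1 on each
-- cycle. Two antichains cover all arcs in 𝓕 except the tops c of the 3-chains a ⊂ b ⊂ c of arcs;
-- moreover they cover every arc comparable to no other arc twice. Butterfly-freeness makes a and
-- c the only members of 𝓕 comparable to b, so b is covered twice on all cycles where it is an arc
-- but a and c are not. Given that b is an arc, the events "a is an arc" and "c is an arc" are
-- independent, of probability at most 2/|b| and 2/(n-|b|), and this makes the gain outweigh the
-- loss on average, for each b separately.

open import Defs
open import Data.Nat using (ℕ; _*_) renaming (_≤_ to _≤ℕ_)
open import Data.Rational using (_/_) renaming (_≤_ to _≤ℚ_)
open import Data.Integer using (+_)
open import Data.Product using (_×_)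
open import Data.Fin.Subset using (∣_∣)
open import Data.List.Relation.Unary.Unique.Propositional using (Unique)
open import Data.List.Membership.Propositional using (_∈_)

open import Data.Bool using (Bool; true; false; not; T; if_then_else_; _∧_) renaming (_≟_ to _≟ᵇ_)
open import Data.Bool.ListAction using (any; all)
open import Data.Bool.Properties using (T?; T-≡; not-involutive)
open import Data.Empty using (⊥-elim)
open import Data.Fin using (Fin; zero; suc; fromℕ<)
open import Data.Fin.Properties using (injective⇒≤; fromℕ<-injective; nonZeroIndex)
open import Data.Fin.Subset using (Subset; _⊆_; _⊂_) renaming (_∈_ to _∈ˢ_)
open import Data.Fin.Subset.Properties using (_⊂?_; x∈p∩q⁻; p⊂q⇒∣p∣<∣q∣; drop-∷-⊆; s⊂s; out⊂in; ⊂-irref; ⊂-trans)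
import Data.Integer as ℤ
import Data.Integer.Properties as ℤ
open import Data.List using (List; []; _∷_; _++_; [_]; map; concatMap; length; filter; filterᵇ; upTo; take; drop; lookup; allFin; tabulate)
open import Data.List.Membership.Propositional using (find; lose)
open import Data.List.Membership.Propositional.Properties using (∈-map⁻; ∈-concatMap⁻; ∈-upTo⁺; ∈-upTo⁻; ∈-filter⁻; ∈-++⁻; ∈-lookup; ∈-allFin)
open import Data.List.Properties using (length-map; ++-assoc; ++-identityʳ; length-++; take++drop≡id; length-take; length-drop; filter-++; length-upTo; length-filter; length-tabulate)
open import Data.List.Relation.Binary.Permutation.Propositional using (_↭_; ↭-refl; ↭-sym; ↭-trans; ↭-prep; ↭-swap; ↭⇒↭ₛ)
open import Data.List.Relation.Binary.Permutation.Propositional.Properties using (∈-resp-↭; ↭-length; filter-↭; ∷↭∷ʳ)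
import Data.List.Relation.Binary.Permutation.Setoid.Properties as Permₛ
open import Data.List.Relation.Unary.All as All using (All; []; _∷_)
import Data.List.Relation.Unary.All.Properties as Allₚ
open import Data.List.Relation.Unary.AllPairs using ([]; _∷_)
open import Data.List.Relation.Unary.Any using (Any; here; there; any?)
import Data.List.Relation.Unary.Any.Properties as Anyₚ
open import Data.List.Relation.Unary.Unique.Propositional.Properties using (upTo⁺; allFin⁺; filter⁺)
open import Data.Nat hiding (_≟_; _/_)
open import Data.Nat.Combinatorics using (_C_; nCk≡n!/k![n-k]!; k![n∸k]!∣n!)
open import Data.Nat.Divisibility using (∣-trans; m∣m*n; m≤n⇒m!∣n!)
open import Data.Nat.DivMod using (_%_; m≡m%n+[m/n]*n; m%n<n; m*[n/m]≡n; m/n*n≡m; /-monoʳ-≤) renaming (_/_ to _/ℕ_)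
open import Data.Nat.Properties hiding (_≟_)
open import Data.Nat.Solver using (module +-*-Solver)
open import Data.Product using (∃-syntax; _,_; proj₁; proj₂; map₂)
import Data.Rational as ℚ
import Data.Rational.Properties as ℚ
open import Data.Rational.Unnormalised as ℚᵘ using (mkℚᵘ; *≡*; *≤*)
import Data.Rational.Unnormalised.Properties as ℚᵘ
open import Data.Sum using (_⊎_; inj₁; inj₂)
open import Data.Unit using (tt)
open import Data.Vec using ([]; _∷_; here) renaming (lookup to lookupᵥ)
open import Data.Vec.Properties using (≡-dec; []=⇒lookup; lookup⇒[]=)
open import Function using (_∘_; id)
open import Function.Bundles using (Equivalence)
open import Level using (Level)
open import Relation.Binary.Definitions using (tri<; tri≈; tri>)
open import Relation.Binary.PropositionalEquality hiding ([_])
open import Relation.Nullary using (¬_; Dec; yes; no; does; contradiction)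
open import Relation.Nullary.Decidable using (_×-dec_; _⊎-dec_; ¬?; dec-true; dec-false)
open import Relation.Unary using (Pred; Decidable)

-- On a cycle where `a`, `b` and `c` are all arcs, `c` is left uncovered and `b`, not being isolated
-- there, gives nothing back; so gain and loss are compared only after summation over all cycles.
-- Write `m`, `k` for the sizes of `b`, `c`, and `M = n - m`. Relative to the cycles on which `b` is
-- an arc, the loss is at most `(2 / m) * (2 / M)` with weight `1 / k`, and the gain at least
-- `(1 - 2 / m) * (1 - 2 / M)` with weight `1 / m`. Here `m ≥ 3` because `a` has two elements, and
-- `M ≥ m + 2` because `m < k` and `2 * k ≤ n`; then the gain is no smaller than the loss. A cyclic
-- order is represented by its `n` linear arrangements, so sums run over `n !` lists, and a set is
-- an arc if some rotation of the list puts it first. Weights are multiplied by `n !`, which keeps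
-- every sum in the natural numbers until the very end.

private variable
  a ℓ : Level
  A B : Set a

-- Finite sums and indicators

𝟙 : Bool → ℕ
𝟙 true  = 1
𝟙 false = 0

∑ : List A → (A → ℕ) → ℕ
∑ []       f = 0
∑ (x ∷ xs) f = f x + ∑ xs f

syntax ∑ xs (λ x → e) = ∑[ x ∈ xs ] e
infix 5 ∑

∑-mono : ∀ (xs : List A) {f g : A → ℕ} → (∀ {x} → x ∈ xs → f x ≤ g x) → ∑ xs f ≤ ∑ xs g
∑-mono []       h = z≤n
∑-mono (x ∷ xs) h = +-mono-≤ (h (here refl)) (∑-mono xs (h ∘ there))

∑-cong : ∀ (xs : List A) {f g : A → ℕ} → (∀ {x} → x ∈ xs → f x ≡ g x) → ∑ xs f ≡ ∑ xs g
∑-cong []       h = refl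
∑-cong (x ∷ xs) h = cong₂ _+_ (h (here refl)) (∑-cong xs (h ∘ there))

∑-distrib-+ : ∀ (xs : List A) (f g : A → ℕ) → ∑ xs (λ x → f x + g x) ≡ ∑ xs f + ∑ xs g
∑-distrib-+ []       f g = refl
∑-distrib-+ (x ∷ xs) f g = begin
  f x + g x + ∑ xs (λ y → f y + g y) ≡⟨ cong (_+_ (f x + g x)) (∑-distrib-+ xs f g) ⟩
  f x + g x + (∑ xs f + ∑ xs g)      ≡⟨ +-*-Solver.solve 4 (λ a b c d → a :+ b :+ (c :+ d) := a :+ c :+ (b :+ d)) refl (f x) (g x) _ _ ⟩
  f x + ∑ xs f + (g x + ∑ xs g)      ∎
  where open ≡-Reasoning
        open +-*-Solver using (_:+_; _:=_)

*-distribˡ-∑ : ∀ c (xs : List A) (f : A → ℕ) → ∑ xs (λ x → c * f x) ≡ c * ∑ xs f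
*-distribˡ-∑ c []       f = sym (*-zeroʳ c)
*-distribˡ-∑ c (x ∷ xs) f =
  trans (cong (_+_ (c * f x)) (*-distribˡ-∑ c xs f)) (sym (*-distribˡ-+ c (f x) (∑ xs f)))

*-distribʳ-∑ : ∀ c (xs : List A) (f : A → ℕ) → ∑ xs (λ x → f x * c) ≡ ∑ xs f * c
*-distribʳ-∑ c xs f =
  trans (∑-cong xs λ {x} _ → *-comm (f x) c) (trans (*-distribˡ-∑ c xs f) (*-comm c (∑ xs f)))

∑-const : ∀ (xs : List A) c → ∑ xs (λ _ → c) ≡ length xs * c
∑-const []       c = refl
∑-const (x ∷ xs) c = cong (_+_ c) (∑-const xs c)

∑-zero : ∀ (xs : List A) {f : A → ℕ} → (∀ {x} → x ∈ xs → f x ≡ 0) → ∑ xs f ≡ 0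
∑-zero xs h = trans (∑-cong xs h) (trans (∑-const xs 0) (*-zeroʳ (length xs)))

∑-swap : ∀ (xs : List A) (ys : List B) (f : A → B → ℕ) →
  ∑[ x ∈ xs ] ∑[ y ∈ ys ] f x y ≡ ∑[ y ∈ ys ] ∑[ x ∈ xs ] f x y
∑-swap []       ys f = sym (∑-zero ys λ _ → refl)
∑-swap (x ∷ xs) ys f = begin
  ∑ ys (f x) + (∑[ x′ ∈ xs ] ∑[ y ∈ ys ] f x′ y) ≡⟨ cong (_+_ (∑ ys (f x))) (∑-swap xs ys f) ⟩
  ∑ ys (f x) + (∑[ y ∈ ys ] ∑[ x′ ∈ xs ] f x′ y) ≡⟨ ∑-distrib-+ ys (f x) _ ⟨
  (∑[ y ∈ ys ] (f x y + ∑ xs (λ x′ → f x′ y)))   ∎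
  where open ≡-Reasoning

∑-++ : ∀ (xs ys : List A) (f : A → ℕ) → ∑ (xs ++ ys) f ≡ ∑ xs f + ∑ ys f
∑-++ []       ys f = refl
∑-++ (x ∷ xs) ys f = trans (cong (_+_ (f x)) (∑-++ xs ys f)) (sym (+-assoc (f x) _ _))

∑-map : ∀ (g : A → B) (xs : List A) (f : B → ℕ) → ∑ (map g xs) f ≡ ∑ xs (f ∘ g)
∑-map g []       f = refl
∑-map g (x ∷ xs) f = cong (_+_ (f (g x))) (∑-map g xs f)

∑-concatMap : ∀ (g : A → List B) (xs : List A) (f : B → ℕ) →
  ∑ (concatMap g xs) f ≡ ∑[ x ∈ xs ] ∑ (g x) f
∑-concatMap g []       f = refl
∑-concatMap g (x ∷ xs) f = trans (∑-++ (g x) _ f) (cong (_+_ (∑ (g x) f)) (∑-concatMap g xs f))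

∑-filter : ∀ {P : Pred A ℓ} (P? : Decidable P) (xs : List A) (f : A → ℕ) →
  ∑ (filter P? xs) f ≡ ∑[ x ∈ xs ] 𝟙 (does (P? x)) * f x
∑-filter P? []       f = refl
∑-filter P? (x ∷ xs) f with does (P? x)
... | true  = cong₂ _+_ (sym (+-identityʳ (f x))) (∑-filter P? xs f)
... | false = ∑-filter P? xs f

∑-product : ∀ (xs : List A) (ys : List B) (f : A → ℕ) (g : B → ℕ) →
  ∑[ x ∈ xs ] ∑[ y ∈ ys ] f x * g y ≡ ∑ xs f * ∑ ys g
∑-product xs ys f g =
  trans (∑-cong xs λ {x} _ → *-distribˡ-∑ (f x) ys g) (*-distribʳ-∑ (∑ ys g) xs f)

𝟙-mono : ∀ {b c} → (T b → T c) → 𝟙 b ≤ 𝟙 c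
𝟙-mono {false}         h = z≤n
𝟙-mono {true}  {true}  h = ≤-refl
𝟙-mono {true}  {false} h = ⊥-elim (h tt)

𝟙-true : ∀ {b} → T b → 𝟙 b ≡ 1
𝟙-true {true} _ = refl

𝟙-false : ∀ {b} → ¬ T b → 𝟙 b ≡ 0
𝟙-false {true}  h = ⊥-elim (h tt)
𝟙-false {false} h = refl

f≤∑ : ∀ {xs : List A} (f : A → ℕ) {x} → x ∈ xs → f x ≤ ∑ xs f
f≤∑ f (here refl) = m≤m+n _ _
f≤∑ f (there x∈)  = ≤-trans (f≤∑ f x∈) (m≤n+m _ _)

any⇒∃ : ∀ (q : A → Bool) xs → T (any q xs) → ∃[ x ] x ∈ xs × T (q x)
any⇒∃ q xs t = find (Anyₚ.any⁻ q xs t)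

∃⇒any : ∀ (q : A → Bool) {x xs} → x ∈ xs → T (q x) → T (any q xs)
∃⇒any q x∈ t = Anyₚ.any⁺ q (lose x∈ t)

𝟙-any≤∑ : ∀ (q : A → Bool) xs → 𝟙 (any q xs) ≤ ∑[ x ∈ xs ] 𝟙 (q x)
𝟙-any≤∑ q []       = z≤n
𝟙-any≤∑ q (x ∷ xs) with q x
... | true  = s≤s z≤n
... | false = 𝟙-any≤∑ q xs

∑-concentrated : ∀ {xs : List A} {f : A → ℕ} c → Unique xs →
  (∀ {x} → x ∈ xs → x ≢ c → f x ≡ 0) → (∀ {x} → x ∈ xs → x ≡ c ⊎ x ≢ c) → ∑ xs f ≤ f c
∑-concentrated {xs = []}     c _ h _ = z≤n
∑-concentrated {xs = x ∷ xs} {f} c (x∉ ∷ u) h d with d (here refl)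
... | inj₁ refl = ≤-reflexive (trans (cong (_+_ (f c)) (∑-zero xs λ y∈ → h (there y∈) λ { refl → All.lookup x∉ y∈ refl })) (+-identityʳ (f c)))
... | inj₂ x≢c = subst (_≤ f c) (cong (_+ ∑ xs f) (sym (h (here refl) x≢c)))
                   (∑-concentrated c u (h ∘ there) (d ∘ there))

∑𝟙≤𝟙-any : ∀ (q : A → Bool) {xs} → Unique xs →
  (∀ {x y} → x ∈ xs → y ∈ xs → T (q x) → T (q y) → x ≡ y) → ∑[ x ∈ xs ] 𝟙 (q x) ≤ 𝟙 (any q xs)
∑𝟙≤𝟙-any q {[]}     _        h = z≤n
∑𝟙≤𝟙-any q {x ∷ xs} (x∉ ∷ u) h with q x in eq
... | false = ∑𝟙≤𝟙-any q u λ x∈ y∈ → h (there x∈) (there y∈)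
... | true  = s≤s (≤-reflexive (∑-zero xs λ {y} y∈ → 𝟙-false λ qy →
                All.lookup x∉ y∈ (h (here refl) (there y∈) (subst T (sym eq) tt) qy)))

-- Arrangements and their invariance under rotation

-- arr m xs lists the arrangements of m entries of xs, by position: repeated entries count separately.

sel : List A → List (A × List A)
sel []       = []
sel (x ∷ xs) = (x , xs) ∷ map (map₂ (x ∷_)) (sel xs)

arr : ℕ → List A → List (List A)
arr zero    xs = [ [] ]
arr (suc m) xs = concatMap (λ (x , ys) → map (x ∷_) (arr m ys)) (sel xs)

∑-sel-∷ : ∀ (x : A) xs (g : A → List A → ℕ) →
  ∑[ (y , ys) ∈ sel (x ∷ xs) ] g y ys ≡ g x xs + (∑[ (y , ys) ∈ sel xs ] g y (x ∷ ys))
∑-sel-∷ x xs g = cong (_+_ (g x xs)) (∑-map (map₂ (x ∷_)) (sel xs) _)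

∑-arr-suc : ∀ m (xs : List A) (f : List A → ℕ) →
  ∑ (arr (suc m) xs) f ≡ ∑[ (x , ys) ∈ sel xs ] ∑[ u ∈ arr m ys ] f (x ∷ u)
∑-arr-suc m xs f = trans (∑-concatMap _ (sel xs) f) (∑-cong (sel xs) λ {(x , ys)} _ → ∑-map (x ∷_) (arr m ys) f)

-- The ordered pairs of positions split into those with the head `w` first (`P`), with `w` second
-- (`Q`), and without `w` (`R`). Transposing the pair exchanges `P` and `Q`; induction handles `R`.
∑-sel-swap : ∀ (xs : List A) (g : A → A → List A → ℕ) →
  ∑[ (x , ys) ∈ sel xs ] ∑[ (y , zs) ∈ sel ys ] g x y zs ≡
  ∑[ (x , ys) ∈ sel xs ] ∑[ (y , zs) ∈ sel ys ] g y x zs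
∑-sel-swap []       g = refl
∑-sel-swap (w ∷ ws) g = begin
  ∑[ (x , ys) ∈ sel (w ∷ ws) ] ∑[ (y , zs) ∈ sel ys ] g x y zs ≡⟨ expand g ⟩
  P g + (Q g + R g)                                           ≡⟨ cong (λ r → P g + (Q g + r)) (∑-sel-swap ws (λ x y zs → g x y (w ∷ zs))) ⟩
  P g + (Q g + R g′)                                          ≡⟨ +-*-Solver.solve 3 (λ a b c → a :+ (b :+ c) := b :+ (a :+ c)) refl (P g) (Q g) _ ⟩
  P g′ + (Q g′ + R g′)                                        ≡⟨ expand g′ ⟨
  ∑[ (x , ys) ∈ sel (w ∷ ws) ] ∑[ (y , zs) ∈ sel ys ] g y x zs ∎
  where
  open ≡-Reasoning
  open +-*-Solver using (_:+_; _:=_)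
  g′ = λ x y zs → g y x zs
  P Q R : (_ → _ → _ → ℕ) → ℕ
  P g = ∑[ (y , zs) ∈ sel ws ] g w y zs
  Q g = ∑[ (x , zs) ∈ sel ws ] g x w zs
  R g = ∑[ (x , ys) ∈ sel ws ] ∑[ (y , zs) ∈ sel ys ] g x y (w ∷ zs)
  expand : ∀ g → ∑[ (x , ys) ∈ sel (w ∷ ws) ] ∑[ (y , zs) ∈ sel ys ] g x y zs ≡ P g + (Q g + R g)
  expand g = trans (∑-sel-∷ w ws _) (cong (_+_ (P g)) (trans
    (∑-cong (sel ws) λ {(x , ys)} _ → ∑-sel-∷ w ys (g x)) (∑-distrib-+ (sel ws) _ _)))

-- Choosing the last entry before the others enumerates the same arrangements: fix both the first
-- and the last entry and transpose the two choices.
∑-arr-last : ∀ m (xs : List A) (f : List A → ℕ) →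
  ∑ (arr (suc m) xs) f ≡ ∑[ (x , ys) ∈ sel xs ] ∑[ u ∈ arr m ys ] f (u ++ [ x ])
∑-arr-last zero    xs f = ∑-arr-suc 0 xs f
∑-arr-last (suc m) xs f = begin
  ∑ (arr (2 + m) xs) f
    ≡⟨ ∑-arr-suc (suc m) xs f ⟩
  ∑[ (x , ys) ∈ sel xs ] ∑[ u ∈ arr (suc m) ys ] f (x ∷ u)
    ≡⟨ ∑-cong (sel xs) (λ {(x , ys)} _ → ∑-arr-last m ys (f ∘ (x ∷_))) ⟩
  ∑[ (x , ys) ∈ sel xs ] ∑[ (y , zs) ∈ sel ys ] ∑[ u ∈ arr m zs ] f (x ∷ u ++ [ y ])
    ≡⟨ ∑-sel-swap xs _ ⟩
  ∑[ (y , ys) ∈ sel xs ] ∑[ (x , zs) ∈ sel ys ] ∑[ u ∈ arr m zs ] f (x ∷ u ++ [ y ])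
    ≡⟨ ∑-cong (sel xs) (λ {(y , ys)} _ → ∑-arr-suc m ys (λ u → f (u ++ [ y ]))) ⟨
  ∑[ (y , ys) ∈ sel xs ] ∑[ u ∈ arr (suc m) ys ] f (u ++ [ y ]) ∎
  where open ≡-Reasoning

rot₁ : List A → List A
rot₁ []       = []
rot₁ (x ∷ xs) = xs ++ [ x ]

rot : ℕ → List A → List A
rot zero    σ = σ
rot (suc s) σ = rot s (rot₁ σ)

-- Expanding the left side by the first entry and the right side by the last one gives the same
-- double sum.
∑-arr-rot₁ : ∀ m (xs : List A) (f : List A → ℕ) → ∑ (arr m xs) (f ∘ rot₁) ≡ ∑ (arr m xs) f
∑-arr-rot₁ zero    xs f = refl
∑-arr-rot₁ (suc m) xs f = trans (∑-arr-suc m xs (f ∘ rot₁)) (sym (∑-arr-last m xs f))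

∑-arr-rot : ∀ s m (xs : List A) (f : List A → ℕ) → ∑ (arr m xs) (f ∘ rot s) ≡ ∑ (arr m xs) f
∑-arr-rot zero    m xs f = refl
∑-arr-rot (suc s) m xs f = trans (∑-arr-rot₁ m xs (f ∘ rot s)) (∑-arr-rot s m xs f)

∈-sel : ∀ {xs : List A} {y ys} → (y , ys) ∈ sel xs → y ∷ ys ↭ xs
∈-sel {xs = x ∷ xs} (here refl) = ↭-refl
∈-sel {xs = x ∷ xs} (there p) with (z , zs) , q , refl ← ∈-map⁻ (map₂ (x ∷_)) p =
  ↭-trans (↭-swap z x ↭-refl) (↭-prep x (∈-sel q))

length-sel : ∀ (xs : List A) → length (sel xs) ≡ length xs
length-sel []       = refl
length-sel (x ∷ xs) = cong suc (trans (length-map _ (sel xs)) (length-sel xs))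

∈-arr : ∀ m {xs σ : List A} → length xs ≡ m → σ ∈ arr m xs → σ ↭ xs
∈-arr zero    {[]} eq (here refl) = ↭-refl
∈-arr (suc m) {xs} {σ} eq σ∈
  with (y , ys) , q , r ← find (∈-concatMap⁻ _ {xs = sel xs} σ∈)
  with τ , τ∈ , refl ← ∈-map⁻ (y ∷_) r =
  ↭-trans (↭-prep y (∈-arr m (suc-injective (trans (↭-length (∈-sel q)) eq)) τ∈)) (∈-sel q)

length-arr : ∀ (xs : List A) → length (arr (length xs) xs) ≡ (length xs) !
length-arr xs = trans (sym (trans (∑-const (arr (length xs) xs) 1) (*-identityʳ _))) (count (length xs) xs refl)
  where
  open ≡-Reasoning
  count : ∀ m (xs : List _) → length xs ≡ m → ∑[ _ ∈ arr m xs ] 1 ≡ m !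
  count zero    xs eq = refl
  count (suc m) xs eq = begin
    ∑[ _ ∈ arr (suc m) xs ] 1                     ≡⟨ ∑-arr-suc m xs _ ⟩
    ∑[ (x , ys) ∈ sel xs ] ∑[ _ ∈ arr m ys ] 1    ≡⟨ ∑-cong (sel xs) (λ {(x , ys)} i → count m ys (suc-injective (trans (↭-length (∈-sel i)) eq))) ⟩
    ∑[ _ ∈ sel xs ] (m !)                         ≡⟨ ∑-const (sel xs) (m !) ⟩
    length (sel xs) * m !                         ≡⟨ cong (_* m !) (trans (length-sel xs) eq) ⟩
    suc m * m !                                   ∎

-- Sorted arrangements

none : (A → Bool) → List A → Bool
none q = all (not ∘ q)

-- All entries satisfying q come first.
sorted : (A → Bool) → List A → Bool
sorted q []       = true
sorted q (x ∷ xs) = if q x then sorted q xs else none q xs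

∑-sel-filter : ∀ (q : A → Bool) (xs : List A) (g : A → List A → List A → ℕ) →
  ∑[ (x , ys) ∈ sel xs ] 𝟙 (q x) * g x (filterᵇ q ys) (filterᵇ (not ∘ q) ys) ≡
  ∑[ (x , us) ∈ sel (filterᵇ q xs) ] g x us (filterᵇ (not ∘ q) xs)
∑-sel-filter q []       g = refl
∑-sel-filter q (w ∷ ws) g = trans (∑-sel-∷ w ws _) (step (q w) refl)
  where
  step : ∀ b → q w ≡ b →
    𝟙 (q w) * g w (filterᵇ q ws) (filterᵇ (not ∘ q) ws) +
    (∑[ (x , ys) ∈ sel ws ] 𝟙 (q x) * g x (filterᵇ q (w ∷ ys)) (filterᵇ (not ∘ q) (w ∷ ys))) ≡
    ∑[ (x , us) ∈ sel (filterᵇ q (w ∷ ws)) ] g x us (filterᵇ (not ∘ q) (w ∷ ws))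
  step true  eq rewrite eq = trans
    (cong₂ _+_ (+-identityʳ _) (∑-sel-filter q ws (λ x us vs → g x (w ∷ us) vs)))
    (sym (∑-sel-∷ w (filterᵇ q ws) (λ x us → g x us (filterᵇ (not ∘ q) ws))))
  step false eq rewrite eq = ∑-sel-filter q ws (λ x us vs → g x us (w ∷ vs))

filterᵇ-none : ∀ (q : A → Bool) xs → length (filterᵇ q xs) ≡ 0 → filterᵇ (not ∘ q) xs ≡ xs × T (none q xs)
filterᵇ-none q []       _ = refl , tt
filterᵇ-none q (x ∷ xs) eq with q x
... | false with e , t ← filterᵇ-none q xs eq = cong (x ∷_) e , t

none⇒filterᵇ : ∀ (q : A → Bool) xs → T (none q xs) → length (filterᵇ q xs) ≡ 0
none⇒filterᵇ q []       _ = refl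
none⇒filterᵇ q (x ∷ xs) t with q x
... | false = none⇒filterᵇ q xs t

none⇒sorted : ∀ (q : A → Bool) xs → T (none q xs) → T (sorted q xs)
none⇒sorted q []       _ = tt
none⇒sorted q (x ∷ xs) t with q x
... | false = t

length-filterᵇ-↭ : ∀ (q : A → Bool) {xs ys} → xs ↭ ys → length (filterᵇ q xs) ≡ length (filterᵇ q ys)
length-filterᵇ-↭ q e = ↭-length (filter-↭ (T? ∘ q) e)

length-filterᵇ+ : ∀ (q : A → Bool) xs → length (filterᵇ q xs) + length (filterᵇ (not ∘ q) xs) ≡ length xs
length-filterᵇ+ q []       = refl
length-filterᵇ+ q (x ∷ xs) with q x
... | true  = cong suc (length-filterᵇ+ q xs)
... | false = trans (+-suc _ _) (cong suc (length-filterᵇ+ q xs))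

-- The source of independence: in a sorted arrangement the entries satisfying `q` and the remaining
-- ones are arranged separately, so the sum runs over a product.
∑-arr-sorted : ∀ (q : A → Bool) j i (xs : List A) (f : List A → ℕ) →
  length (filterᵇ q xs) ≡ j → length (filterᵇ (not ∘ q) xs) ≡ i →
  ∑[ σ ∈ arr (j + i) xs ] 𝟙 (sorted q σ) * f σ ≡
  ∑[ u ∈ arr j (filterᵇ q xs) ] ∑[ v ∈ arr i (filterᵇ (not ∘ q) xs) ] f (u ++ v)
∑-arr-sorted q zero i xs f ej ei with e , t ← filterᵇ-none q xs ej = begin
  ∑[ σ ∈ arr i xs ] 𝟙 (sorted q σ) * f σ      ≡⟨ ∑-cong (arr i xs) (λ {σ} σ∈ → trans (cong (_* f σ) (𝟙-true
                                                    (none⇒sorted q σ (proj₂ (filterᵇ-none q σ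
                                                      (trans (length-filterᵇ-↭ q (∈-arr i len σ∈)) ej))))))
                                                    (+-identityʳ (f σ))) ⟩
  ∑ (arr i xs) f                              ≡⟨ cong (λ ys → ∑ (arr i ys) f) e ⟨
  ∑ (arr i (filterᵇ (not ∘ q) xs)) f          ≡⟨ +-identityʳ _ ⟨
  ∑ (arr i (filterᵇ (not ∘ q) xs)) f + 0      ∎
  where open ≡-Reasoning
        len : length xs ≡ i
        len = trans (sym (length-filterᵇ+ q xs)) (cong₂ _+_ ej ei)
∑-arr-sorted {A = A} q (suc j) i xs f ej ei = begin
  ∑[ σ ∈ arr (suc j + i) xs ] 𝟙 (sorted q σ) * f σ
    ≡⟨ ∑-arr-suc (j + i) xs _ ⟩
  ∑[ (x , ys) ∈ sel xs ] ∑[ σ ∈ arr (j + i) ys ] 𝟙 (sorted q (x ∷ σ)) * f (x ∷ σ)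
    ≡⟨ ∑-cong (sel xs) (λ {(x , ys)} → inner x ys) ⟩
  ∑[ (x , ys) ∈ sel xs ] 𝟙 (q x) * h x (filterᵇ q ys) (filterᵇ (not ∘ q) ys)
    ≡⟨ ∑-sel-filter q xs h ⟩
  ∑[ (x , us) ∈ sel (filterᵇ q xs) ] h x us (filterᵇ (not ∘ q) xs)
    ≡⟨ ∑-arr-suc j (filterᵇ q xs) _ ⟨
  ∑[ u ∈ arr (suc j) (filterᵇ q xs) ] ∑[ v ∈ arr i (filterᵇ (not ∘ q) xs) ] f (u ++ v) ∎
  where
  open ≡-Reasoning
  h : A → List A → List A → ℕ
  h x us vs = ∑[ u ∈ arr j us ] ∑[ v ∈ arr i vs ] f (x ∷ u ++ v)
  inner : ∀ x ys → (x , ys) ∈ sel xs →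
    ∑[ σ ∈ arr (j + i) ys ] 𝟙 (sorted q (x ∷ σ)) * f (x ∷ σ) ≡
    𝟙 (q x) * h x (filterᵇ q ys) (filterᵇ (not ∘ q) ys)
  inner x ys m with q x
                  | trans (length-filterᵇ-↭ q (∈-sel m)) ej
                  | trans (length-filterᵇ-↭ (not ∘ q) (∈-sel m)) ei
  ... | true  | lj | li = trans (∑-arr-sorted q j i ys (f ∘ (x ∷_)) (suc-injective lj) li)
                                           (sym (+-identityʳ _))
  -- The first entry fails `q` while `suc j` entries satisfying `q` are still to come, so nothing
  -- here is sorted.
  ... | false | lj | li = ∑-zero (arr (j + i) ys) λ {σ} σ∈ →
      cong (_* f (x ∷ σ)) (𝟙-false λ t → contradiction
        (trans (sym (none⇒filterᵇ q σ t)) (trans (length-filterᵇ-↭ q (∈-arr (j + i) len σ∈)) lj)) λ ())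
    where len : length ys ≡ j + i
          len = suc-injective (trans (↭-length (∈-sel m)) (trans (sym (length-filterᵇ+ q xs)) (cong₂ _+_ ej ei)))

-- Rotations of sorted lists

rot-+ : ∀ s t (σ : List A) → rot (s + t) σ ≡ rot t (rot s σ)
rot-+ zero    t σ = refl
rot-+ (suc s) t σ = rot-+ s t (rot₁ σ)

rot₁-↭ : ∀ (σ : List A) → rot₁ σ ↭ σ
rot₁-↭ []      = ↭-refl
rot₁-↭ (x ∷ σ) = ↭-sym (∷↭∷ʳ x σ)

rot-↭ : ∀ s (σ : List A) → rot s σ ↭ σ
rot-↭ zero    σ = ↭-refl
rot-↭ (suc s) σ = ↭-trans (rot-↭ s (rot₁ σ)) (rot₁-↭ σ)

rot-++ : ∀ (u v : List A) → rot (length u) (u ++ v) ≡ v ++ u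
rot-++ []      v = sym (++-identityʳ v)
rot-++ (x ∷ u) v = begin
  rot (length u) ((u ++ v) ++ [ x ]) ≡⟨ cong (rot (length u)) (++-assoc u v [ x ]) ⟩
  rot (length u) (u ++ v ++ [ x ])   ≡⟨ rot-++ u (v ++ [ x ]) ⟩
  (v ++ [ x ]) ++ u                  ≡⟨ ++-assoc v [ x ] u ⟩
  v ++ x ∷ u                         ∎
  where open ≡-Reasoning

rot-length : ∀ (σ : List A) → rot (length σ) σ ≡ σ
rot-length σ = trans (cong (rot (length σ)) (sym (++-identityʳ σ))) (rot-++ σ [])

rot-*length : ∀ k (σ : List A) → rot (k * length σ) σ ≡ σ
rot-*length zero    σ = refl
rot-*length (suc k) σ = trans (rot-+ (length σ) (k * length σ) σ)
  (trans (cong (rot (k * length σ)) (rot-length σ)) (rot-*length k σ))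

rot-take : ∀ s (u v : List A) → s ≤ length u → rot s (u ++ v) ≡ drop s u ++ v ++ take s u
rot-take s u v s≤ = begin
  rot s (u ++ v)                                       ≡⟨ cong₂ rot (trans (length-take s u) (m≤n⇒m⊓n≡m s≤))
                                                          (cong (_++ v) (take++drop≡id s u)) ⟨
  rot (length (take s u)) ((take s u ++ drop s u) ++ v) ≡⟨ cong (rot (length (take s u))) (++-assoc (take s u) (drop s u) v) ⟩
  rot (length (take s u)) (take s u ++ drop s u ++ v)   ≡⟨ rot-++ (take s u) (drop s u ++ v) ⟩
  (drop s u ++ v) ++ take s u                          ≡⟨ ++-assoc (drop s u) v (take s u) ⟩
  drop s u ++ v ++ take s u                            ∎
  where open ≡-Reasoning

rot-drop : ∀ s (u v : List A) → s ≤ length v → rot (length u + s) (u ++ v) ≡ drop s v ++ u ++ take s v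
rot-drop s u v s≤ = trans (rot-+ (length u) s (u ++ v)) (trans (cong (rot s) (rot-++ u v)) (rot-take s v u s≤))

count : (A → Bool) → List A → ℕ
count q xs = length (filterᵇ q xs)

count-++ : ∀ (q : A → Bool) xs ys → count q (xs ++ ys) ≡ count q xs + count q ys
count-++ q xs ys = trans (cong length (filter-++ (T? ∘ q) xs ys)) (length-++ (filterᵇ q xs))

none-++⁻ : ∀ (q : A → Bool) xs {ys} → T (none q (xs ++ ys)) → T (none q xs) × T (none q ys)
none-++⁻ q []       t = tt , t
none-++⁻ q (x ∷ xs) t with q x
... | false = none-++⁻ q xs t

none-++⁺ : ∀ (q : A → Bool) xs {ys} → T (none q xs) → T (none q ys) → T (none q (xs ++ ys))
none-++⁺ q []       _ t = t
none-++⁺ q (x ∷ xs) s t with q x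
... | false = none-++⁺ q xs s t

sorted-++⁺ : ∀ (q : A → Bool) xs {ys} → T (sorted q xs) → T (none q ys) → T (sorted q (xs ++ ys))
sorted-++⁺ q [] {ys} _ t = none⇒sorted q ys t
sorted-++⁺ q (x ∷ xs) s t with q x
... | true  = sorted-++⁺ q xs s t
... | false = none-++⁺ q xs s t

sorted-gap : ∀ (q : A → Bool) x y {z} → 1 ≤ length y → T (none q y) →
  T (sorted q (x ++ y ++ z)) → T (sorted q x) × T (none q z)
sorted-gap q [] (w ∷ y) _ n s with q w
... | false = tt , proj₂ (none-++⁻ q y s)
sorted-gap q (w ∷ x) y l n s with q w
... | true  = sorted-gap q x y l n s
... | false with nx , nyz ← none-++⁻ q x s = nx , proj₂ (none-++⁻ q y nyz)

all⇒count : ∀ (q : A → Bool) xs → T (all q xs) → count q xs ≡ length xs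
all⇒count q []       _ = refl
all⇒count q (x ∷ xs) t with q x
... | true = cong suc (all⇒count q xs t)

none-all : ∀ (q : A → Bool) xs → T (all q xs) → T (none q xs) → length xs ≡ 0
none-all q xs a n = trans (sym (all⇒count q xs a)) (none⇒filterᵇ q xs n)

sorted⁻ : ∀ (q : A → Bool) σ → T (sorted q σ) → ∃[ u ] ∃[ v ] σ ≡ u ++ v × T (all q u) × T (none q v)
sorted⁻ q []      _ = [] , [] , refl , tt , tt
sorted⁻ q (x ∷ σ) t with q x in eq
... | true with u , v , e , a , n ← sorted⁻ q σ t = x ∷ u , v , cong (x ∷_) e , subst T (sym (cong (_∧ all q u) eq)) a , n
... | false = [] , x ∷ σ , refl , tt , subst (λ b → T (not b ∧ none q σ)) (sym eq) t

all⇒sorted : ∀ (q : A → Bool) u → T (all q u) → T (sorted q u)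
all⇒sorted q []      _ = tt
all⇒sorted q (x ∷ u) t with q x
... | true = all⇒sorted q u t

all-take : ∀ (q : A → Bool) s u → T (all q u) → T (all q (take s u))
all-take q zero    u       t = tt
all-take q (suc s) []      t = tt
all-take q (suc s) (x ∷ u) t with q x
... | true = all-take q s u t

all-drop : ∀ (q : A → Bool) s u → T (all q u) → T (all q (drop s u))
all-drop q zero    u       t = t
all-drop q (suc s) []      t = tt
all-drop q (suc s) (x ∷ u) t with q x
... | true = all-drop q s u t

all∈ : ∀ (q : A → Bool) xs → (∀ {x} → x ∈ xs → T (q x)) → T (all q xs)
all∈ q xs h = Allₚ.all⁻ q (All.tabulate h)

Tnot : ∀ {b} → ¬ T b → T (not b)
Tnot {true}  h = h tt
Tnot {false} h = tt

notT : ∀ {b} → T (not b) → ¬ T b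
notT {false} _ ()

T-antisym : ∀ {b c} → (T b → T c) → (T c → T b) → b ≡ c
T-antisym {true}  {true}  f g = refl
T-antisym {true}  {false} f g = ⊥-elim (f tt)
T-antisym {false} {true}  f g = ⊥-elim (g tt)
T-antisym {false} {false} f g = refl

-- Makes the start of an arc unique. Write the list as `u ++ v`, with `q` true on `u` and false on
-- `v`. A rotation cutting `u` leaves entries of `u` behind the nonempty `v`; one cutting `v` leaves
-- all of `u` behind a nonempty piece of `v`. Neither is sorted.
sorted-rot-unique : ∀ (q : A → Bool) d ρ → 0 < d → d < length ρ → 0 < count q ρ → count q ρ < length ρ →
  T (sorted q ρ) → ¬ T (sorted q (rot d ρ))
sorted-rot-unique q d ρ 0<d d<l 0<c c<l t t′
  with u , v , refl , au , nv ← sorted⁻ q ρ t with d ≤? length u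
... | yes d≤u = n≮n 0 (subst (0 <_) (trans (sym (trans (length-take d u) (m≤n⇒m⊓n≡m d≤u)))
                  (none-all q (take d u) (all-take q d u au) (proj₂ (sorted-gap q (drop d u) v v≥1 nv
                    (subst (T ∘ sorted q) (rot-take d u v d≤u) t′))))) 0<d)
  where
  v≥1 : 1 ≤ length v
  v≥1 = n≢0⇒n>0 λ e → <-irrefl refl (<-≤-trans c<l (≤-reflexive (begin
    length (u ++ v)       ≡⟨ length-++ u ⟩
    length u + length v   ≡⟨ cong₂ _+_ (all⇒count q u au) (trans (none⇒filterᵇ q v nv) (sym e)) ⟨
    count q u + count q v ≡⟨ count-++ q u v ⟨
    count q (u ++ v)      ∎)))
    where open ≡-Reasoning
... | no d≰u = n≮n 0 (subst (0 <_) (trans (count-++ q u v) (cong₂ _+_ (none⇒filterᵇ q u nu) (none⇒filterᵇ q v nv))) 0<c)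
  where
  e = d ∸ length u
  d≡ : length u + e ≡ d
  d≡ = m+[n∸m]≡n (<⇒≤ (≰⇒> d≰u))
  e<v : e < length v
  e<v = +-cancelˡ-< (length u) e (length v) (subst₂ _<_ (sym d≡) (length-++ u) d<l)
  nu : T (none q u)
  nu = proj₁ (none-++⁻ q u (proj₂ (sorted-gap q [] (drop e v) {u ++ take e v}
         (subst (1 ≤_) (sym (length-drop e v)) (m<n⇒0<n∸m e<v)) (all-drop (not ∘ q) e v nv)
         (subst (T ∘ sorted q) (trans (cong (λ d → rot d (u ++ v)) (sym d≡)) (rot-drop e u v (<⇒≤ e<v))) t′))))

-- Arcs

-- The bound `r` separates the cyclic from the linear notion: with `r = length σ` the block may run
-- across the end of `σ`, whereas with `r = length σ - count q σ + 1` it must be an interval of the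
-- list itself.
block : (A → Bool) → ℕ → List A → Bool
block q r σ = any (λ s → sorted q (rot s σ)) (upTo r)

arc : (A → Bool) → List A → Bool
arc q σ = block q (length σ) σ

block⁺ : ∀ (q : A → Bool) {r s} σ → s < r → T (sorted q (rot s σ)) → T (block q r σ)
block⁺ q σ s<r t = ∃⇒any _ (∈-upTo⁺ s<r) t

block⁻ : ∀ (q : A → Bool) r σ → T (block q r σ) → ∃[ s ] s < r × T (sorted q (rot s σ))
block⁻ q r σ t with s , i , t′ ← any⇒∃ _ (upTo r) t = s , ∈-upTo⁻ i , t′

arc⁺ : ∀ (q : A → Bool) s σ → 0 < length σ → T (sorted q (rot s σ)) → T (arc q σ)
arc⁺ q s σ 0<l t = block⁺ q σ (m%n<n s (length σ)) (subst (T ∘ sorted q) (begin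
    rot s σ                                                  ≡⟨ cong (λ s → rot s σ) (trans (m≡m%n+[m/n]*n s (length σ)) (+-comm _ (s /ℕ length σ * length σ))) ⟩
    rot (s /ℕ length σ * length σ + s % length σ) σ           ≡⟨ rot-+ (s /ℕ length σ * length σ) _ σ ⟩
    rot (s % length σ) (rot (s /ℕ length σ * length σ) σ)     ≡⟨ cong (rot (s % length σ)) (rot-*length (s /ℕ length σ) σ) ⟩
    rot (s % length σ) σ                                     ∎) t)
  where
  open ≡-Reasoning
  instance _ = >-nonZero 0<l

length-rot₁ : ∀ (σ : List A) → length (rot₁ σ) ≡ length σ
length-rot₁ σ = ↭-length (rot₁-↭ σ)

arc-rot₁ : ∀ (q : A → Bool) σ → arc q (rot₁ σ) ≡ arc q σ
arc-rot₁ q σ = T-antisym to from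
  where
  to : T (arc q (rot₁ σ)) → T (arc q σ)
  to t with s , s< , t′ ← block⁻ q (length (rot₁ σ)) (rot₁ σ) t =
    arc⁺ q (suc s) σ (subst (0 <_) (length-rot₁ σ) (m<n⇒0<n s<)) t′
  from : T (arc q σ) → T (arc q (rot₁ σ))
  from t with s , s< , t′ ← block⁻ q (length σ) σ t
    with length σ | rot-length σ | length-rot₁ σ
  -- Undoing one rotation amounts to `l` further ones, `l` being one less than the length.
  ... | suc l | e | e′ = arc⁺ q (l + s) (rot₁ σ) (subst (0 <_) (sym e′) z<s)
     (subst (T ∘ sorted q) (trans (cong (rot s) (sym e)) (sym (rot-+ l s (rot₁ σ)))) t′)

arc-rot : ∀ s (q : A → Bool) σ → arc q (rot s σ) ≡ arc q σ
arc-rot zero    q σ = refl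
arc-rot (suc s) q σ = trans (arc-rot s q (rot₁ σ)) (arc-rot₁ q σ)

arc-++-comm : ∀ (q : A → Bool) u v → arc q (u ++ v) ≡ arc q (v ++ u)
arc-++-comm q u v = trans (sym (arc-rot (length u) q (u ++ v))) (cong (arc q) (rot-++ u v))

all-not-not : ∀ (q : A → Bool) u → T (all q u) → T (none (not ∘ q) u)
all-not-not q []      _ = tt
all-not-not q (x ∷ u) t with q x
... | true = all-not-not q u t

-- Once the arc is in front as `u`, rotating by `length u` brings the complement `v` to the front.
arc-not : ∀ (q : A → Bool) σ → T (arc q σ) → T (arc (not ∘ q) σ)
arc-not q σ t with s , s< , t′ ← block⁻ q (length σ) σ t
  with u , v , e , au , nv ← sorted⁻ q (rot s σ) t′ =
  arc⁺ (not ∘ q) (s + length u) σ (m<n⇒0<n s<)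
    (subst (T ∘ sorted (not ∘ q)) (sym (trans (rot-+ s (length u) σ) (trans (cong (rot (length u)) e) (rot-++ u v))))
      (sorted-++⁺ (not ∘ q) v (all⇒sorted (not ∘ q) v nv) (all-not-not q u au)))

-- The nonempty `v` contains no element of the arc, so the arc cannot run across `v` and is an
-- interval of `u`. This cuts the possible starts from `length u` to `length u - count q u + 1`. A
-- start strictly inside `v` would put a piece of `v` ahead of all of `u`, leaving the arc empty.
arc-++⇒block : ∀ (q : A → Bool) u v → 1 ≤ length v → T (none q v) → 1 ≤ count q u →
  T (arc q (u ++ v)) → T (block q (suc (length u ∸ count q u)) u)
arc-++⇒block q u v 1≤v nv 1≤c t with s , s< , t′ ← block⁻ q _ (u ++ v) t with s ≤? length u
... | yes s≤u = block⁺ q u (s≤s s≤) (subst (T ∘ sorted q) (sym rot≡) (sorted-++⁺ q (drop s u) (proj₁ gap) (proj₂ gap)))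
  where
  gap = sorted-gap q (drop s u) v {take s u} 1≤v nv (subst (T ∘ sorted q) (rot-take s u v s≤u) t′)
  rot≡ : rot s u ≡ drop s u ++ take s u
  rot≡ = trans (cong (rot s) (sym (++-identityʳ u))) (rot-take s u [] s≤u)
  s≤ : s ≤ length u ∸ count q u
  s≤ = m+n≤o⇒m≤o∸n s (begin
    s + count q u                                  ≡⟨ cong (λ w → s + count q w) (take++drop≡id s u) ⟨
    s + count q (take s u ++ drop s u)             ≡⟨ cong (_+_ s) (count-++ q (take s u) (drop s u)) ⟩
    s + (count q (take s u) + count q (drop s u))  ≡⟨ cong (λ k → s + (k + count q (drop s u))) (none⇒filterᵇ q (take s u) (proj₂ gap)) ⟩
    s + count q (drop s u)                         ≤⟨ +-monoʳ-≤ s (length-filter (T? ∘ q) (drop s u)) ⟩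
    s + length (drop s u)                          ≡⟨ cong (_+_ s) (length-drop s u) ⟩
    s + (length u ∸ s)                             ≡⟨ m+[n∸m]≡n s≤u ⟩
    length u                                       ∎)
    where open ≤-Reasoning
... | no s≰u = contradiction (none⇒filterᵇ q u nu) (>⇒≢ 1≤c)
  where
  e = s ∸ length u
  s≡ : length u + e ≡ s
  s≡ = m+[n∸m]≡n (<⇒≤ (≰⇒> s≰u))
  e<v : e < length v
  e<v = +-cancelˡ-< (length u) e (length v) (subst₂ _<_ (sym s≡) (length-++ u) s<)
  nu : T (none q u)
  nu = proj₁ (none-++⁻ q u (proj₂ (sorted-gap q [] (drop e v) {u ++ take e v}
         (subst (1 ≤_) (sym (length-drop e v)) (m<n⇒0<n∸m e<v)) (all-drop (not ∘ q) e v nv)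
         (subst (T ∘ sorted q) (trans (cong (λ d → rot d (u ++ v)) (sym s≡)) (rot-drop e u v (<⇒≤ e<v))) t′))))

-- Counting arrangements

∑-arr-𝟙-sorted : ∀ (q : A → Bool) xs {j i} → count q xs ≡ j → count (not ∘ q) xs ≡ i →
  ∑[ σ ∈ arr (j + i) xs ] 𝟙 (sorted q σ) ≡ j ! * i !
∑-arr-𝟙-sorted q xs {j} {i} refl refl = begin
  ∑[ σ ∈ arr (j + i) xs ] 𝟙 (sorted q σ)       ≡⟨ ∑-cong (arr (j + i) xs) (λ _ → sym (*-identityʳ _)) ⟩
  ∑[ σ ∈ arr (j + i) xs ] 𝟙 (sorted q σ) * 1   ≡⟨ ∑-arr-sorted q j i xs (λ _ → 1) refl refl ⟩
  ∑[ u ∈ U ] ∑[ v ∈ V ] 1                      ≡⟨ ∑-cong U (λ _ → trans (∑-const V 1) (*-identityʳ _)) ⟩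
  ∑[ u ∈ U ] length V                          ≡⟨ ∑-const U _ ⟩
  length U * length V                          ≡⟨ cong₂ _*_ (length-arr (filterᵇ q xs)) (length-arr (filterᵇ (not ∘ q) xs)) ⟩
  j ! * i !                                    ∎
  where
  open ≡-Reasoning
  U = arr j (filterᵇ q xs)
  V = arr i (filterᵇ (not ∘ q) xs)

-- A union bound over the `r` starts, which contribute equally by rotation invariance.
∑-arr-block : ∀ (q : A → Bool) r xs {j i} → count q xs ≡ j → count (not ∘ q) xs ≡ i →
  ∑[ σ ∈ arr (j + i) xs ] 𝟙 (block q r σ) ≤ r * (j ! * i !)
∑-arr-block q r xs {j} {i} ej ei = begin
  ∑[ σ ∈ X ] 𝟙 (block q r σ)                           ≤⟨ ∑-mono X (λ _ → 𝟙-any≤∑ _ (upTo r)) ⟩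
  ∑[ σ ∈ X ] ∑[ s ∈ upTo r ] 𝟙 (sorted q (rot s σ))    ≡⟨ ∑-swap X (upTo r) _ ⟩
  ∑[ s ∈ upTo r ] ∑[ σ ∈ X ] 𝟙 (sorted q (rot s σ))    ≡⟨ ∑-cong (upTo r) (λ {s} _ → ∑-arr-rot s (j + i) xs (𝟙 ∘ sorted q)) ⟩
  ∑[ s ∈ upTo r ] ∑[ σ ∈ X ] 𝟙 (sorted q σ)            ≡⟨ ∑-const (upTo r) _ ⟩
  length (upTo r) * ∑ X (𝟙 ∘ sorted q)                 ≡⟨ cong₂ _*_ (length-upTo r) (∑-arr-𝟙-sorted q xs ej ei) ⟩
  r * (j ! * i !)                                      ∎
  where
  open ≤-Reasoning
  X = arr (j + i) xs

-- A nonempty proper arc has exactly one of `n` starts, and each start can be rotated to the front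
-- without changing `g`.
∑-arr-arc : ∀ (q : A → Bool) xs {n} → length xs ≡ n → 0 < count q xs → count q xs < n →
  (g : List A → ℕ) → (∀ σ → g (rot₁ σ) ≡ g σ) →
  ∑[ σ ∈ arr n xs ] 𝟙 (arc q σ) * g σ ≡ n * (∑[ σ ∈ arr n xs ] 𝟙 (sorted q σ) * g σ)
∑-arr-arc q xs {n} len 0<c c<n g g-rot = begin
  ∑[ σ ∈ X ] 𝟙 (arc q σ) * g σ                                   ≡⟨ ∑-cong X (λ {σ} i → cong (_* g σ) (arc≡∑ σ i)) ⟩
  ∑[ σ ∈ X ] (∑[ s ∈ upTo n ] 𝟙 (sorted q (rot s σ))) * g σ      ≡⟨ ∑-cong X (λ {σ} _ → *-distribʳ-∑ (g σ) (upTo n) _) ⟨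
  ∑[ σ ∈ X ] ∑[ s ∈ upTo n ] 𝟙 (sorted q (rot s σ)) * g σ        ≡⟨ ∑-swap X (upTo n) _ ⟩
  ∑[ s ∈ upTo n ] ∑[ σ ∈ X ] 𝟙 (sorted q (rot s σ)) * g σ        ≡⟨ ∑-cong (upTo n) (λ {s} _ → shift s) ⟩
  ∑[ s ∈ upTo n ] ∑[ σ ∈ X ] 𝟙 (sorted q σ) * g σ                ≡⟨ ∑-const (upTo n) _ ⟩
  length (upTo n) * (∑[ σ ∈ X ] 𝟙 (sorted q σ) * g σ)            ≡⟨ cong (_* ∑ X (λ σ → 𝟙 (sorted q σ) * g σ)) (length-upTo n) ⟩
  n * (∑[ σ ∈ X ] 𝟙 (sorted q σ) * g σ)                          ∎
  where
  open ≡-Reasoning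
  X = arr n xs
  g-rots : ∀ s σ → g (rot s σ) ≡ g σ
  g-rots zero    σ = refl
  g-rots (suc s) σ = trans (g-rots s (rot₁ σ)) (g-rot σ)
  shift : ∀ s → ∑[ σ ∈ X ] 𝟙 (sorted q (rot s σ)) * g σ ≡ ∑[ σ ∈ X ] 𝟙 (sorted q σ) * g σ
  shift s = trans (∑-cong X λ {σ} _ → cong (𝟙 (sorted q (rot s σ)) *_) (sym (g-rots s σ)))
                  (∑-arr-rot s n xs (λ σ → 𝟙 (sorted q σ) * g σ))
  arc≡∑ : ∀ σ → σ ∈ X → 𝟙 (arc q σ) ≡ ∑[ s ∈ upTo n ] 𝟙 (sorted q (rot s σ))
  arc≡∑ σ i = subst (λ l → 𝟙 (block q l σ) ≡ ∑[ s ∈ upTo n ] 𝟙 (sorted q (rot s σ))) (sym lσ)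
    (≤-antisym (𝟙-any≤∑ _ (upTo n)) (∑𝟙≤𝟙-any _ (upTo⁺ n) λ x∈ y∈ → unique (∈-upTo⁻ x∈) (∈-upTo⁻ y∈)))
    where
    σ↭xs : σ ↭ xs
    σ↭xs = ∈-arr n len i
    lσ : length σ ≡ n
    lσ = trans (↭-length σ↭xs) len
    clash : ∀ {s t} → s < t → t < n → T (sorted q (rot s σ)) → ¬ T (sorted q (rot t σ))
    clash {s} {t} s<t t<n ts tt′ = sorted-rot-unique q (t ∸ s) (rot s σ) (m<n⇒0<n∸m s<t)
      (subst (t ∸ s <_) (sym lρ) (≤-<-trans (m∸n≤m t s) t<n))
      (subst (0 <_) (sym cρ) 0<c) (subst₂ _<_ (sym cρ) (sym lρ) c<n) ts
      (subst (T ∘ sorted q) (trans (cong (λ d → rot d σ) (sym (m+[n∸m]≡n (<⇒≤ s<t)))) (rot-+ s (t ∸ s) σ)) tt′)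
      where
      ρ↭xs : rot s σ ↭ xs
      ρ↭xs = ↭-trans (rot-↭ s σ) σ↭xs
      lρ = trans (↭-length ρ↭xs) len
      cρ = length-filterᵇ-↭ q ρ↭xs
    unique : ∀ {s t} → s < n → t < n → T (sorted q (rot s σ)) → T (sorted q (rot t σ)) → s ≡ t
    unique {s} {t} s<n t<n ts tt′ with <-cmp s t
    ... | tri< s<t _ _ = ⊥-elim (clash s<t t<n ts tt′)
    ... | tri≈ _ eq _  = eq
    ... | tri> _ _ t<s = ⊥-elim (clash t<s s<n tt′ ts)

-- Estimates for factorials

-- For two numbers that are at least 2 and have a fixed sum, the product of factorials is largest
-- when one of them equals 2.
!*!≤ : ∀ i j → (2 + i) ! * (2 + j) ! ≤ 2 * (2 + i + j) !
!*!≤ i zero = ≤-reflexive (trans (*-comm ((2 + i) !) 2) (cong (λ k → 2 * (2 + k) !) (sym (+-identityʳ i))))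
!*!≤ i (suc j) = begin
  (2 + i) ! * ((3 + j) * (2 + j) !)   ≡⟨ solve 3 (λ x y z → x :* (y :* z) := y :* (x :* z)) refl ((2 + i) !) (3 + j) ((2 + j) !) ⟩
  (3 + j) * ((2 + i) ! * (2 + j) !)   ≤⟨ *-mono-≤ (+-monoʳ-≤ 3 (m≤n+m j i)) (!*!≤ i j) ⟩
  (3 + i + j) * (2 * (2 + i + j) !)   ≡⟨ solve 2 (λ y z → y :* (con 2 :* z) := con 2 :* (y :* z)) refl (3 + i + j) ((2 + i + j) !) ⟩
  2 * (3 + i + j) !                   ≡⟨ cong (λ k → 2 * (2 + k) !) (+-suc i j) ⟨
  2 * (2 + i + suc j) !               ∎
  where open ≤-Reasoning
        open +-*-Solver

-- After division by `m !`: `j` given entries out of `m` form an interval with probability at most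
-- `2 / m`. The left side is `(i + 1) ! * j !`. Having `j ≥ 2` is essential, as a single entry is
-- always an interval; this is where members need two elements.
block-bound : ∀ {m i j} → 1 ≤ i → 2 ≤ j → j + i ≡ m → suc i * (j ! * i !) ≤ 2 * (m ∸ 1) !
block-bound {i = suc i} {suc (suc j)} _ _ refl = begin
  (2 + i) * ((2 + j) ! * suc i !)  ≡⟨ solve 3 (λ x y z → x :* (y :* z) := (x :* z) :* y) refl (2 + i) ((2 + j) !) (suc i !) ⟩
  (2 + i) ! * (2 + j) !            ≤⟨ !*!≤ i j ⟩
  2 * (2 + i + j) !                ≡⟨ cong (λ k → 2 * k !) (solve 2 (λ i j → con 2 :+ i :+ j := con 1 :+ j :+ (con 1 :+ i)) refl i j) ⟩
  2 * (suc j + suc i) !            ∎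
  where open ≤-Reasoning
        open +-*-Solver
block-bound {j = suc zero} _ (s≤s ()) _

complement-bound : ∀ p p′ F c → p + p′ ≡ (2 + c) * F → p ≤ 2 * F → c * F ≤ p′
complement-bound p p′ F c eq p≤ = +-cancelˡ-≤ (2 * F) (c * F) p′ (begin
  2 * F + c * F ≡⟨ *-distribʳ-+ F 2 c ⟨
  (2 + c) * F   ≡⟨ eq ⟨
  p + p′        ≤⟨ +-monoˡ-≤ p′ p≤ ⟩
  2 * F + p′    ∎)
  where open ≤-Reasoning

-- With p ≤ 2 (m-1)! and q ≤ 2 (M-1)! this comes down to 4 m ≤ (m+1)(m-2)(M-2), an equality for
-- m = 3, M = 5: weighting the right-hand side by k > m rather than m cannot be avoided.
exchange-arith : ∀ {m M k p p′ q q′} → 3 ≤ m → 2 + m ≤ M → m < k →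
  p + p′ ≡ m ! → p ≤ 2 * (m ∸ 1) ! → q + q′ ≡ M ! → q ≤ 2 * (M ∸ 1) ! →
  m * (p * q) ≤ k * (p′ * q′)
exchange-arith {m@(suc (suc (suc m₀)))} {suc (suc M)} {k} {p} {p′} {q} {q′} (s≤s (s≤s (s≤s _))) (s≤s (s≤s m≤M)) m<k ep pb eq qb = begin
  m * (p * q)                                ≤⟨ *-monoʳ-≤ m (*-mono-≤ pb qb) ⟩
  m * ((2 * F) * (2 * G))                    ≡⟨ solve 3 (λ m F G → m :* ((con 2 :* F) :* (con 2 :* G)) := con 4 :* ((F :* m) :* G)) refl m F G ⟩
  4 * ((F * m) * G)                          ≤⟨ m≤m+n _ _ ⟩
  -- The added coefficient is `(m + 1) * (m - 2) - 4` written in `m₀ = m - 3`; it vanishes at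
  -- `m = 3`.
  4 * ((F * m) * G) + (m₀ * m₀ + 5 * m₀) * ((F * m) * G)
                                             ≡⟨ solve 3 (λ m F G → con 4 :* ((F :* (con 3 :+ m)) :* G) :+ (m :* m :+ con 5 :* m) :* ((F :* (con 3 :+ m)) :* G)
                                                                 := (con 4 :+ m) :* ((con 1 :+ m) :* F :* ((con 3 :+ m) :* G))) refl m₀ F G ⟩
  (4 + m₀) * ((1 + m₀) * F * (m * G))        ≤⟨ *-mono-≤ m<k (*-mono-≤ (complement-bound p p′ F (1 + m₀) ep pb)
                                                  (≤-trans (*-monoˡ-≤ G m≤M) (complement-bound q q′ G M eq qb))) ⟩
  k * (p′ * q′)                              ∎
  where open ≤-Reasoning
        open +-*-Solver
        F = (2 + m₀) !
        G = (1 + M) !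

count-filterᵇ : ∀ (q r : A → Bool) xs → (∀ x → T (q x) → T (r x)) → count q (filterᵇ r xs) ≡ count q xs
count-filterᵇ q r []       h = refl
count-filterᵇ q r (x ∷ xs) h with r x in rx | q x in qx
... | true  | true  rewrite qx = cong suc (count-filterᵇ q r xs h)
... | true  | false rewrite qx = count-filterᵇ q r xs h
... | false | true  = ⊥-elim (subst T rx (h x (subst T (sym qx) tt)))
... | false | false = count-filterᵇ q r xs h

∑-𝟙-not : ∀ (xs : List A) (q : A → Bool) → ∑ xs (𝟙 ∘ q) + ∑ xs (𝟙 ∘ not ∘ q) ≡ length xs
∑-𝟙-not []       q = refl
∑-𝟙-not (x ∷ xs) q with q x
... | true  = cong suc (∑-𝟙-not xs q)
... | false = trans (+-suc _ _) (cong suc (∑-𝟙-not xs q))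

not-anti : ∀ {b c} → (T b → T c) → T (not c) → T (not b)
not-anti h t = Tnot (notT t ∘ h)

-- Splitting an arrangement in which b comes first into its b-part u and the rest v makes the
-- events "a is an arc" and "c is an arc" (that is, the complement of c is) depend on u and v only.
module Exchange {A : Set a} (xs : List A) (a b c : A → Bool)
  (a⇒b : ∀ x → T (a x) → T (b x)) (b⇒c : ∀ x → T (b x) → T (c x))
  (2≤a : 2 ≤ count a xs) (a<b : count a xs < count b xs) (b<c : count b xs < count c xs)
  (2c≤n : 2 * count c xs ≤ length xs) where

  private
    n m M k d : ℕ
    n = length xs
    m = count b xs
    M = count (not ∘ b) xs
    k = count c xs
    d = count (not ∘ c) xs

    bs bc : List A
    bs = filterᵇ b xs
    bc = filterᵇ (not ∘ b) xs

    m+M≡n : m + M ≡ n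
    m+M≡n = length-filterᵇ+ b xs

    k+d≡n : k + d ≡ n
    k+d≡n = length-filterᵇ+ c xs

    3≤m : 3 ≤ m
    3≤m = ≤-trans (s≤s 2≤a) a<b

    m+2≤M : 2 + m ≤ M
    m+2≤M = +-cancelˡ-≤ m (2 + m) M (begin
      m + (2 + m)      ≡⟨ solve 1 (λ m → m :+ (con 2 :+ m) := con 2 :* (con 1 :+ m)) refl m ⟩
      2 * suc m        ≤⟨ *-monoʳ-≤ 2 b<c ⟩
      2 * k            ≤⟨ 2c≤n ⟩
      n                ≡⟨ m+M≡n ⟨
      m + M            ∎)
      where open ≤-Reasoning
            open +-*-Solver

    k≤d : k ≤ d
    k≤d = +-cancelˡ-≤ k k d (subst₂ _≤_ (cong (_+_ k) (+-identityʳ k)) (sym k+d≡n) 2c≤n)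

    d<M : d < M
    d<M = +-cancelˡ-< m d M (<-≤-trans (+-monoˡ-< d b<c) (≤-reflexive (trans k+d≡n (sym m+M≡n))))

    U V : List (List A)
    U = arr m bs
    V = arr M bc

    -- On `u` and on `v` alone, arcs have become intervals. By the implications `arc-a` and `arc-c`,
    -- products of a function of `u` and a function of `v` bound `both` from above and `neither`
    -- from below.
    α γ : List A → Bool
    α = block a (suc (m ∸ count a xs))
    γ = block (not ∘ c) (suc (M ∸ d))

    ca : count a bs ≡ count a xs
    ca = count-filterᵇ a b xs a⇒b

    cc : count (not ∘ c) bc ≡ d
    cc = count-filterᵇ (not ∘ c) (not ∘ b) xs (λ x → not-anti (b⇒c x))

    ca′ : count (not ∘ a) bs ≡ m ∸ count a xs
    ca′ = sym (trans (cong (_∸ count a xs) (sym (length-filterᵇ+ a bs)))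
                 (trans (cong (λ j → j + count (not ∘ a) bs ∸ count a xs) ca) (m+n∸m≡n (count a xs) _)))

    cc′ : count (not ∘ (not ∘ c)) bc ≡ M ∸ d
    cc′ = sym (trans (cong (_∸ d) (sym (length-filterᵇ+ (not ∘ c) bc)))
                 (trans (cong (λ j → j + count (not ∘ (not ∘ c)) bc ∸ d) cc) (m+n∸m≡n d _)))

    ∑α∑γ : ∑ U (𝟙 ∘ α) ≤ 2 * (m ∸ 1) ! × ∑ V (𝟙 ∘ γ) ≤ 2 * (M ∸ 1) !
    ∑α∑γ =
      ≤-trans (subst (λ l → ∑ (arr l bs) (𝟙 ∘ α) ≤ suc (m ∸ count a xs) * (count a xs ! * (m ∸ count a xs) !)) (m+[n∸m]≡n (<⇒≤ a<b)) (∑-arr-block a (suc (m ∸ count a xs)) bs ca ca′))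
              (block-bound (m<n⇒0<n∸m a<b) 2≤a (m+[n∸m]≡n (<⇒≤ a<b))) ,
      ≤-trans (subst (λ l → ∑ (arr l bc) (𝟙 ∘ γ) ≤ suc (M ∸ d) * (d ! * (M ∸ d) !)) (m+[n∸m]≡n (<⇒≤ d<M)) (∑-arr-block (not ∘ c) (suc (M ∸ d)) bc cc cc′))
              (block-bound (m<n⇒0<n∸m d<M) (≤-trans (≤-trans 2≤a (<⇒≤ (<-trans a<b b<c))) k≤d) (m+[n∸m]≡n (<⇒≤ d<M)))

    b-on : ∀ {u} → u ∈ U → ∀ {x} → x ∈ u → T (b x)
    b-on u∈ x∈ = proj₂ (∈-filter⁻ (T? ∘ b) {xs = xs} (∈-resp-↭ (∈-arr m refl u∈) x∈))

    b-off : ∀ {v} → v ∈ V → ∀ {x} → x ∈ v → T (not (b x))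
    b-off v∈ x∈ = proj₂ (∈-filter⁻ (T? ∘ not ∘ b) {xs = xs} (∈-resp-↭ (∈-arr M refl v∈) x∈))

    arc-a : ∀ {u v} → u ∈ U → v ∈ V → T (arc a (u ++ v)) → T (α u)
    arc-a {u} {v} u∈ v∈ t = subst (λ r → T (block a (suc r) u)) (cong₂ _∸_ (↭-length (∈-arr m refl u∈)) cu)
      (arc-++⇒block a u v (subst (1 ≤_) (sym (↭-length (∈-arr M refl v∈))) (≤-trans (s≤s z≤n) m+2≤M))
        (all∈ (not ∘ a) v λ x∈ → not-anti (a⇒b _) (b-off v∈ x∈))
        (subst (1 ≤_) (sym cu) (<⇒≤ 2≤a)) t)
      where
      cu : count a u ≡ count a xs
      cu = trans (length-filterᵇ-↭ a (∈-arr m refl u∈)) ca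

    arc-c : ∀ {u v} → u ∈ U → v ∈ V → T (arc c (u ++ v)) → T (γ v)
    arc-c {u} {v} u∈ v∈ t = subst (λ r → T (block (not ∘ c) (suc r) v)) (cong₂ _∸_ (↭-length (∈-arr M refl v∈)) cv)
      (arc-++⇒block (not ∘ c) v u (subst (1 ≤_) (sym (↭-length (∈-arr m refl u∈))) (≤-trans (s≤s z≤n) 3≤m))
        (all∈ (not ∘ (not ∘ c)) u λ {x} x∈ → subst T (sym (not-involutive (c x))) (b⇒c x (b-on u∈ x∈)))
        (subst (1 ≤_) (sym cv) (≤-trans (≤-trans (s≤s z≤n) b<c) k≤d))
        (subst T (arc-++-comm (not ∘ c) u v) (arc-not c (u ++ v) t)))
      where
      cv : count (not ∘ c) v ≡ d
      cv = trans (length-filterᵇ-↭ (not ∘ c) (∈-arr M refl v∈)) cc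

  both neither : List A → ℕ
  both    σ = 𝟙 (arc a σ) * 𝟙 (arc c σ)
  neither σ = 𝟙 (not (arc a σ)) * 𝟙 (not (arc c σ))

  private
    -- The factor `n` counts the places where the arc `b` may start.
    split : ∀ (g : List A → ℕ) → (∀ σ → g (rot₁ σ) ≡ g σ) →
      ∑[ σ ∈ arr n xs ] 𝟙 (arc b σ) * g σ ≡ n * (∑[ u ∈ U ] ∑[ v ∈ V ] g (u ++ v))
    split g g-rot = trans
      (∑-arr-arc b xs refl (≤-trans (s≤s z≤n) 3≤m) (<-≤-trans b<c (≤-trans (m≤m+n k d) (≤-reflexive k+d≡n))) g g-rot)
      (cong (n *_) (trans (cong (λ l → ∑ (arr l xs) (λ σ → 𝟙 (sorted b σ) * g σ)) (sym m+M≡n)) (∑-arr-sorted b m M xs g refl refl)))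

  -- Divided by `m * k`, this compares the loss of `c` with weight `1 / k`, when all three sets are
  -- arcs, with the gain of `b` with weight `1 / m`, when only `b` is.
  exchange : m * (∑[ σ ∈ arr n xs ] 𝟙 (arc b σ) * both σ) ≤ k * (∑[ σ ∈ arr n xs ] 𝟙 (arc b σ) * neither σ)
  exchange = begin
    m * (∑[ σ ∈ arr n xs ] 𝟙 (arc b σ) * both σ)         ≡⟨ cong (m *_) (split both λ σ → cong₂ (λ x y → 𝟙 x * 𝟙 y) (arc-rot₁ a σ) (arc-rot₁ c σ)) ⟩
    m * (n * (∑[ u ∈ U ] ∑[ v ∈ V ] both (u ++ v)))      ≤⟨ *-monoʳ-≤ m (*-monoʳ-≤ n (∑-mono U λ u∈ → ∑-mono V λ v∈ →
                                                              *-mono-≤ (𝟙-mono (arc-a u∈ v∈)) (𝟙-mono (arc-c u∈ v∈)))) ⟩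
    m * (n * (∑[ u ∈ U ] ∑[ v ∈ V ] 𝟙 (α u) * 𝟙 (γ v)))  ≡⟨ cong (λ s → m * (n * s)) (∑-product U V (𝟙 ∘ α) (𝟙 ∘ γ)) ⟩
    m * (n * (p * q))                                    ≡⟨ solve 3 (λ m n x → m :* (n :* x) := n :* (m :* x)) refl m n (p * q) ⟩
    n * (m * (p * q))                                    ≤⟨ *-monoʳ-≤ n (exchange-arith 3≤m m+2≤M b<c
                                                              (trans (∑-𝟙-not U α) (length-arr bs)) (proj₁ ∑α∑γ)
                                                              (trans (∑-𝟙-not V γ) (length-arr bc)) (proj₂ ∑α∑γ)) ⟩
    n * (k * (p′ * q′))                                  ≡⟨ solve 3 (λ m n x → m :* (n :* x) := n :* (m :* x)) refl n k (p′ * q′) ⟩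
    k * (n * (p′ * q′))                                  ≡⟨ cong (λ s → k * (n * s)) (∑-product U V (𝟙 ∘ not ∘ α) (𝟙 ∘ not ∘ γ)) ⟨
    k * (n * (∑[ u ∈ U ] ∑[ v ∈ V ] 𝟙 (not (α u)) * 𝟙 (not (γ v))))
                                                         ≤⟨ *-monoʳ-≤ k (*-monoʳ-≤ n (∑-mono U λ u∈ → ∑-mono V λ v∈ →
                                                              *-mono-≤ (𝟙-mono (not-anti (arc-a u∈ v∈))) (𝟙-mono (not-anti (arc-c u∈ v∈))))) ⟩
    k * (n * (∑[ u ∈ U ] ∑[ v ∈ V ] neither (u ++ v)))   ≡⟨ cong (k *_) (split neither λ σ → cong₂ (λ x y → 𝟙 (not x) * 𝟙 (not y)) (arc-rot₁ a σ) (arc-rot₁ c σ)) ⟨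
    k * (∑[ σ ∈ arr n xs ] 𝟙 (arc b σ) * neither σ)      ∎
    where
    open ≤-Reasoning
    open +-*-Solver
    p p′ q q′ : ℕ
    p  = ∑ U (𝟙 ∘ α)
    p′ = ∑ U (𝟙 ∘ not ∘ α)
    q  = ∑ V (𝟙 ∘ γ)
    q′ = ∑ V (𝟙 ∘ not ∘ γ)

-- Katona's bound for one cycle

+-comm-right : ∀ k m n → k + m + n ≡ k + n + m
+-comm-right k m n = trans (+-assoc k m n) (trans (cong (_+_ k) (+-comm m n)) (sym (+-assoc k n m)))

lookup-injective : ∀ {a} {A : Set a} {xs : List A} → Unique xs → ∀ {i j} → lookup xs i ≡ lookup xs j → i ≡ j
lookup-injective (x∉ ∷ u) {zero}  {zero}  eq = refl
lookup-injective (x∉ ∷ u) {zero}  {suc j} eq = contradiction eq (All.lookup x∉ (∈-lookup j))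
lookup-injective (x∉ ∷ u) {suc i} {zero}  eq = contradiction (sym eq) (All.lookup x∉ (∈-lookup i))
lookup-injective (x∉ ∷ u) {suc i} {suc j} eq = cong suc (lookup-injective u eq)

-- Pigeonhole with a relation as the code: injectivity can be proved for any two related pairs,
-- without unfolding how `code` made its choices.
length≤ : ∀ {a r} {A : Set a} {R : A → ℕ → Set r} {xs} k → Unique xs →
  (∀ {x} → x ∈ xs → ∃[ e ] e < k × R x e) →
  (∀ {x y e} → x ∈ xs → y ∈ xs → R x e → R y e → x ≡ y) → length xs ≤ k
length≤ {R = R} {xs} k u code inj = injective⇒≤ {f = λ i → fromℕ< (proj₁ (proj₂ (code (∈-lookup {xs = xs} i))))} λ {i} {j} eq →
  lookup-injective u (inj (∈-lookup i) (∈-lookup j) (proj₂ (proj₂ (code (∈-lookup i))))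
    (subst (R _) (sym (fromℕ<-injective _ _ _ _ eq)) (proj₂ (proj₂ (code (∈-lookup j))))))

∃-minimal : ∀ {a} {A : Set a} (f : A → ℕ) x xs → ∃[ y ] y ∈ x ∷ xs × (∀ {z} → z ∈ x ∷ xs → f y ≤ f z)
∃-minimal f x []       = x , here refl , λ { (here refl) → ≤-refl }
∃-minimal f x (w ∷ xs) with y , y∈ , min ← ∃-minimal f w xs with ≤-total (f x) (f y)
... | inj₁ le = x , here refl , λ { (here refl) → ≤-refl ; (there z∈) → ≤-trans le (min z∈) }
... | inj₂ ge = y , there y∈ , λ { (here refl) → ge ; (there z∈) → min z∈ }

-- The cycle is unrolled to a periodic sequence, so that arcs become intervals of natural numbers
-- and going round once means adding `n`.
module Cycle {n : ℕ} (τ : ℕ → Fin n)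
  (τ-periodic : ∀ i → τ (i + n) ≡ τ i) (τ-injective : ∀ {i j} → i < j → j < i + n → τ i ≢ τ j) where

  record IsArc (F : Subset n) (s : ℕ) : Set where
    constructor mkArc
    field
      member : ∀ i → i < ∣ F ∣ → τ (s + i) ∈ˢ F
      index  : ∀ {x} → x ∈ˢ F → ∃[ i ] i < ∣ F ∣ × τ (s + i) ≡ x
  open IsArc

  Meets : Subset n → Subset n → Set
  Meets A B = ∃[ x ] x ∈ˢ A × x ∈ˢ B

  shift-arc : ∀ {F s} → IsArc F s → IsArc F (s + n)
  shift-arc {F} {s} f = mkArc (λ i i< → subst (_∈ˢ F) (sym (per i)) (member f i i<))
    λ x∈ → let i , i< , e = index f x∈ in i , i< , trans (per i) e
    where
    per : ∀ i → τ (s + n + i) ≡ τ (s + i)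
    per i = trans (cong τ (+-comm-right s n i)) (τ-periodic (s + i))

  arc-⊆ : ∀ {A B s t} k → IsArc A s → IsArc B t → t + k ≡ s → k + ∣ A ∣ ≤ ∣ B ∣ → A ⊆ B
  arc-⊆ {B = B} {t = t} k f g refl k≤ x∈ with i , i< , refl ← index f x∈ =
    subst (λ p → τ p ∈ˢ B) (sym (+-assoc t k i)) (member g (k + i) (<-≤-trans (+-monoʳ-< k i<) k≤))

  record Clutter (A B : Subset n) : Set where
    field
      small  : ∣ A ∣ + ∣ B ∣ ≤ n
      meets  : Meets A B
      ⊆⇒≡    : A ⊆ B → A ≡ B
      ⊇⇒≡    : B ⊆ A → A ≡ B
  open Clutter

  -- The arcs other than A that meet A without containing it are told apart by where they
  -- start in A or, failing that, where they end in A.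
  data Code (A : Subset n) (s : ℕ) (B : Subset n) : ℕ → Set where
    same  : B ≡ A → Code A s B 0
    start : ∀ {e} → 0 < e → IsArc B (s + e) → Code A s B e
    end   : ∀ {e t} → 0 < e → IsArc B t → t + ∣ B ∣ ≡ s + n + e → Code A s B e

  -- With `A` no larger than `B`, a common start forces `A ⊆ B`, hence equality. If `B` starts later
  -- inside `A`, that start is the code. If it starts beyond `A`, it can meet `A` only by going
  -- round; then it ends inside `A`, or contains `A` and equals it.
  code-exists : ∀ {A B s} d → IsArc A s → IsArc B (s + d) → d < n → 0 < ∣ A ∣ → ∣ A ∣ ≤ ∣ B ∣ →
    Clutter A B → ∃[ e ] e < ∣ A ∣ × Code A s B e
  code-exists zero f g _ 0<A A≤B c =
    0 , 0<A , same (sym (⊆⇒≡ c (arc-⊆ 0 f g (trans (+-identityʳ _) (+-identityʳ _)) A≤B)))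
  code-exists {A} {B} {s} (suc d) f g d<n 0<A A≤B c with suc d <? ∣ A ∣
  ... | yes d<A = suc d , d<A , start z<s g
  ... | no d≮A with x , x∈A , x∈B ← meets c
    with i , i<A , ei ← index f x∈A | j , j<B , ej ← index g x∈B = later (suc d + j ≤? n + i)
    where
    open ≤-Reasoning
    l = ∣ B ∣
    A≤d : ∣ A ∣ ≤ suc d
    A≤d = ≮⇒≥ d≮A
    -- B starts beyond A, so the common point, at s + i in A, occurs in B as s + i + n.
    n≤ : n + i ≤ suc d + j
    n≤ = ≮⇒≥ λ lt → τ-injective {s + i} {s + suc d + j}
      (subst (s + i <_) (sym (+-assoc s (suc d) j)) (+-monoʳ-< s (<-≤-trans i<A (≤-trans A≤d (m≤m+n _ j)))))
      (subst₂ _<_ (sym (+-assoc s (suc d) j)) (trans (cong (_+_ s) (+-comm n i)) (sym (+-assoc s i n))) (+-monoʳ-< s lt))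
      (trans ei (sym ej))
    later : Dec (suc d + j ≤ n + i) → ∃[ e ] e < ∣ A ∣ × Code A s B e
    later (no ≰) = contradiction (trans (τ-periodic (s + i)) (trans ei (sym ej)))
      (τ-injective {s + i + n} {s + suc d + j}
        (subst₂ _<_ (trans (cong (_+_ s) (+-comm n i)) (sym (+-assoc s i n))) (sym (+-assoc s (suc d) j)) (+-monoʳ-< s (≰⇒> ≰)))
        (begin-strict
          s + suc d + j   ≡⟨ +-assoc s (suc d) j ⟩
          s + (suc d + j) <⟨ +-monoʳ-< s (+-mono-< d<n (<-≤-trans j<B (≤-trans (m≤n+m l ∣ A ∣) (small c)))) ⟩
          s + (n + n)     ≤⟨ m≤m+n _ i ⟩
          s + (n + n) + i ≡⟨ solve 3 (λ s n i → s :+ (n :+ n) :+ i := s :+ i :+ n :+ n) refl s n i ⟩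
          s + i + n + n   ∎))
      where open +-*-Solver
    later (yes _) = wrap (e <? ∣ A ∣)
      where
      e = suc d + l ∸ n
      n< : n < suc d + l
      n< = ≤-<-trans (≤-trans (m≤m+n n i) n≤) (+-monoʳ-< (suc d) j<B)
      n+e : n + e ≡ suc d + l
      n+e = m+[n∸m]≡n (<⇒≤ n<)
      wrap : Dec (e < ∣ A ∣) → ∃[ e ] e < ∣ A ∣ × Code A s B e
      wrap (yes e<A) = e , e<A , end (m<n⇒0<n∸m n<) g
        (trans (+-assoc s (suc d) l) (trans (cong (_+_ s) (sym n+e)) (sym (+-assoc s n e))))
      -- `B` reaches the end of the next copy of `A`, at `s + n`, and started before that copy.
      wrap (no e≮A) = 0 , 0<A , same (sym (⊆⇒≡ c (arc-⊆ (n ∸ suc d) (shift-arc f) g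
        (trans (+-assoc s (suc d) _) (cong (_+_ s) (m+[n∸m]≡n (<⇒≤ d<n))))
        (+-cancelˡ-≤ (suc d) _ l (begin
          suc d + (n ∸ suc d + ∣ A ∣) ≡⟨ +-assoc (suc d) _ _ ⟨
          suc d + (n ∸ suc d) + ∣ A ∣ ≡⟨ cong (_+ ∣ A ∣) (m+[n∸m]≡n (<⇒≤ d<n)) ⟩
          n + ∣ A ∣                   ≤⟨ +-monoʳ-≤ n (≮⇒≥ e≮A) ⟩
          n + e                       ≡⟨ n+e ⟩
          suc d + l                   ∎)))))

  -- Katona's pairing: if `D` ends, one turn later, just where `B` starts, the two fit side by side
  -- on the cycle because together they have at most `n` elements. They are then disjoint. This is
  -- the use of `|F| ≤ n / 2` in Katona's bound.
  start≢end : ∀ {B D s t} → IsArc B s → IsArc D t → t + ∣ D ∣ ≡ s + n → ∣ B ∣ + ∣ D ∣ ≤ n → ¬ Meets B D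
  start≢end {B} {D} {s} {t} f g eq sm (x , x∈B , x∈D)
    with i , i< , ei ← index f x∈B | j , j< , ej ← index g x∈D =
    τ-injective (<-≤-trans (+-monoʳ-< s i<) (≤-trans s+B≤t (m≤m+n t j)))
      (<-≤-trans (+-monoʳ-< t j<) (≤-trans (≤-reflexive eq) (+-monoˡ-≤ n (m≤m+n s i))))
      (trans ei (sym ej))
    where
    open ≤-Reasoning
    s+B≤t : s + ∣ B ∣ ≤ t
    s+B≤t = +-cancelʳ-≤ ∣ D ∣ (s + ∣ B ∣) t (begin
      s + ∣ B ∣ + ∣ D ∣   ≡⟨ +-assoc s ∣ B ∣ ∣ D ∣ ⟩
      s + (∣ B ∣ + ∣ D ∣) ≤⟨ +-monoʳ-≤ s sm ⟩
      s + n               ≡⟨ eq ⟨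
      t + ∣ D ∣           ∎)

  end-⊆ : ∀ {B D t u} → IsArc B t → IsArc D u → t + ∣ B ∣ ≡ u + ∣ D ∣ → ∣ B ∣ ≤ ∣ D ∣ → B ⊆ D
  end-⊆ {B} {D} {t} {u} f g eq le = arc-⊆ (∣ D ∣ ∸ ∣ B ∣) f g
    (+-cancelʳ-≡ ∣ B ∣ _ t (trans (+-assoc u _ _) (trans (cong (_+_ u) (m∸n+n≡m le)) (sym eq))))
    (≤-reflexive (m∸n+n≡m le))

  -- Arcs with a common start or a common end are nested, hence equal in an antichain; a start and
  -- an end with the same code would give disjoint arcs.
  code-injective : ∀ {A s B D e} → Clutter B D → Code A s B e → Code A s D e → B ≡ D
  code-injective c (same refl)   (same refl)    = refl
  code-injective {B = B} {D} c (start _ f) (start _ g) with ≤-total ∣ B ∣ ∣ D ∣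
  ... | inj₁ le = ⊆⇒≡ c (arc-⊆ 0 f g (+-identityʳ _) le)
  ... | inj₂ ge = ⊇⇒≡ c (arc-⊆ 0 g f (+-identityʳ _) ge)
  code-injective {s = s} {e = e} c (start _ f) (end _ g eq) =
    ⊥-elim (start≢end f g (trans eq (+-comm-right s n e)) (small c) (meets c))
  code-injective {s = s} {B} {D} {e} c (end _ f eq) (start _ g) =
    ⊥-elim (start≢end g f (trans eq (+-comm-right s n e))
      (subst (_≤ n) (+-comm ∣ B ∣ ∣ D ∣) (small c)) (let x , x∈B , x∈D = meets c in x , x∈D , x∈B))
  code-injective {B = B} {D} c (end _ f eq) (end _ g eq′) with ≤-total ∣ B ∣ ∣ D ∣
  ... | inj₁ le = ⊆⇒≡ c (end-⊆ f g (trans eq (sym eq′)) le)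
  ... | inj₂ ge = ⊇⇒≡ c (end-⊆ g f (trans eq′ (sym eq)) ge)
  code-injective c (same _)     (start () _)
  code-injective c (same _)     (end () _ _)
  code-injective c (start () _) (same _)
  code-injective c (end () _ _) (same _)

  -- For a member `A` of least size there are at most `∣ A ∣` codes, hence at most `∣ A ∣` members,
  -- none heavier than `A` since `W` is antitone.
  ∑-clutter : ∀ {L} (W : ℕ → ℕ) (G : List (Subset n)) →
    (∀ {k l} → 0 < k → k ≤ l → l ≤ n → W l ≤ W k) → (∀ {k} → 0 < k → k ≤ n → k * W k ≤ L) → Unique G →
    (∀ {A} → A ∈ G → (∃[ s ] s < n × IsArc A s) × 0 < ∣ A ∣) →
    (∀ {A B} → A ∈ G → B ∈ G → Clutter A B) →
    ∑[ F ∈ G ] W ∣ F ∣ ≤ L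
  ∑-clutter W []        _   _  _ _   _       = z≤n
  ∑-clutter {L} W G@(F ∷ Fs) W-anti W≤ u arcs clutter with A , A∈ , min ← ∃-minimal ∣_∣ F Fs
    with (s , s<n , f) , 0<A ← arcs A∈ = begin
    ∑[ B ∈ G ] W ∣ B ∣ ≤⟨ ∑-mono G (λ B∈ → W-anti 0<A (min B∈) (size≤n B∈)) ⟩
    ∑[ B ∈ G ] W ∣ A ∣ ≡⟨ ∑-const G _ ⟩
    length G * W ∣ A ∣ ≤⟨ *-monoˡ-≤ (W ∣ A ∣) (length≤ {R = Code A s} ∣ A ∣ u code λ B∈ D∈ → code-injective (clutter B∈ D∈)) ⟩
    ∣ A ∣ * W ∣ A ∣    ≤⟨ W≤ 0<A (size≤n A∈) ⟩
    L                  ∎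
    where
    open ≤-Reasoning
    size≤n : ∀ {B} → B ∈ G → ∣ B ∣ ≤ n
    size≤n B∈ = ≤-trans (m≤m+n _ _) (small (clutter B∈ B∈))
    from-s : ∀ {B t} → t < n → IsArc B t → ∃[ d ] d < n × IsArc B (s + d)
    from-s {B} {t} t<n g with s ≤? t
    ... | yes s≤t = t ∸ s , ≤-<-trans (m∸n≤m t s) t<n , subst (IsArc B) (sym (m+[n∸m]≡n s≤t)) g
    ... | no s≰t  = t + n ∸ s , m<n+o⇒m∸n<o (t + n) s {{>-nonZero (≤-<-trans z≤n t<n)}} (+-monoˡ-< n (≰⇒> s≰t)) ,
      subst (IsArc B) (sym (m+[n∸m]≡n (≤-trans (<⇒≤ s<n) (m≤n+m n t)))) (shift-arc g)
    code : ∀ {B} → B ∈ G → ∃[ e ] e < ∣ A ∣ × Code A s B e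
    code B∈ with (t , t<n , g) , _ ← arcs B∈ with d , d<n , g′ ← from-s t<n g =
      code-exists d f g′ d<n 0<A (min B∈) (clutter A∈ B∈)

Unique-resp-↭ : ∀ {a} {A : Set a} {xs ys : List A} → xs ↭ ys → Unique xs → Unique ys
Unique-resp-↭ p = Permₛ.Unique-resp-↭ (setoid _) (↭⇒↭ₛ p)

∈ˢ⇒T : ∀ {n} {F : Subset n} {x} → x ∈ˢ F → T (lookupᵥ F x)
∈ˢ⇒T x∈ = Equivalence.from T-≡ ([]=⇒lookup x∈)

T⇒∈ˢ : ∀ {n} {F : Subset n} {x} → T (lookupᵥ F x) → x ∈ˢ F
T⇒∈ˢ t = lookup⇒[]= _ _ (Equivalence.to T-≡ t)

count-tabulate : ∀ {m n} (F : Subset m) (f : Fin m → Fin n) (q : Fin n → Bool) →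
  (∀ i → q (f i) ≡ lookupᵥ F i) → count q (tabulate f) ≡ ∣ F ∣
count-tabulate []          f q h = refl
count-tabulate (b ∷ F) f q h with q (f zero) | b | h zero
... | true  | _ | refl = cong suc (count-tabulate F (f ∘ suc) q (h ∘ suc))
... | false | _ | refl = count-tabulate F (f ∘ suc) q (h ∘ suc)

count-allFin : ∀ {n} (F : Subset n) → count (lookupᵥ F) (allFin n) ≡ ∣ F ∣
count-allFin F = count-tabulate F id (lookupᵥ F) λ _ → refl

-- Positions

headOr : ∀ {a} {A : Set a} → A → List A → A
headOr d []      = d
headOr d (x ∷ _) = x

head-rot : ∀ {a p} {A : Set a} {P : A → Set p} d i (u v : List A) → All P u → i < length u → P (headOr d (rot i (u ++ v)))
head-rot d zero    (x ∷ u) v (px ∷ _)  _         = px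
head-rot {P = P} d (suc i) (x ∷ u) v (_ ∷ pu) (s≤s i<) =
  subst (λ w → P (headOr d (rot i w))) (sym (++-assoc u v [ x ])) (head-rot d i u (v ++ [ x ]) pu i<)

rot-find : ∀ {a} {A : Set a} d {x : A} u v → x ∈ u → ∃[ i ] i < length u × headOr d (rot i (u ++ v)) ≡ x
rot-find d (x ∷ u) v (here refl) = 0 , z<s , refl
rot-find d (y ∷ u) v (there x∈) with i , i< , e ← rot-find d u (v ++ [ y ]) x∈ =
  suc i , s<s i< , trans (cong (headOr d ∘ rot i) (++-assoc u v [ y ])) e

-- Reading position `i` off the head of a rotation gives periodicity without modular arithmetic. The
-- default `x₀` is for empty lists, and its own existence shows that `σ` is not empty.
module Positions {n} (σ : List (Fin n)) (σ↭ : σ ↭ allFin n) (x₀ : Fin n) where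

  τ : ℕ → Fin n
  τ i = headOr x₀ (rot i σ)

  length-σ : length σ ≡ n
  length-σ = trans (↭-length σ↭) (length-tabulate id)

  τ-periodic : ∀ i → τ (i + n) ≡ τ i
  τ-periodic i = cong (headOr x₀) (begin
    rot (i + n) σ            ≡⟨ cong (λ k → rot k σ) (trans (+-comm i n) (cong (_+ i) (sym length-σ))) ⟩
    rot (length σ + i) σ     ≡⟨ rot-+ (length σ) i σ ⟩
    rot i (rot (length σ) σ) ≡⟨ cong (rot i) (rot-length σ) ⟩
    rot i σ                  ∎)
    where open ≡-Reasoning

  -- After rotation by `i` the entry `τ i` is the head `x`, whereas `τ j` lies in the tail `ρ`,
  -- which does not contain `x` again.
  τ-injective : ∀ {i j} → i < j → j < i + n → τ i ≢ τ j
  τ-injective {i} {j} i<j j<i+n with rot i σ in eq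
    | Unique-resp-↭ (↭-sym (↭-trans (rot-↭ i σ) σ↭)) (allFin⁺ n)
    | trans (↭-length (rot-↭ i σ)) length-σ
    | j ∸ i | m+[n∸m]≡n (<⇒≤ i<j)
  ... | _      | _      | _  | zero  | refl = λ _ → <-irrefl refl (subst (i <_) (+-identityʳ i) i<j)
  ... | []     | _      | l  | suc d | refl = λ _ → n≮n (i + suc d) (<-≤-trans j<i+n (subst (λ m → i + m ≤ i + suc d) l (+-monoʳ-≤ i z≤n)))
  ... | x ∷ ρ  | x∉ ∷ _ | l  | suc d | refl = λ x≡ → head-rot {P = x ≢_} x₀ d ρ [ x ] x∉
        (s<s⁻¹ (subst (suc d <_) (sym l) (+-cancelˡ-< i (suc d) n j<i+n)))
        (trans x≡ (cong (headOr x₀) (trans (rot-+ i (suc d) σ) (cong (rot (suc d)) eq))))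

  open Cycle τ τ-periodic τ-injective public

  arc⇒IsArc : ∀ F → T (arc (lookupᵥ F) σ) → ∃[ s ] s < n × IsArc F s
  arc⇒IsArc F t with s , s< , t′ ← block⁻ (lookupᵥ F) (length σ) σ t
    with u , v , e , au , nv ← sorted⁻ (lookupᵥ F) (rot s σ) t′ =
    s , subst (s <_) length-σ s< , mkArc
      (λ i i< → subst (_∈ˢ F) (τ≡ i) (head-rot {P = _∈ˢ F} x₀ i u v (All.map T⇒∈ˢ (Allₚ.all⁺ _ u au)) (subst (i <_) (sym lu) i<)))
      (λ {x} x∈ → let i , i< , eq = rot-find x₀ u v (in-u x∈) in i , subst (i <_) lu i< , trans (sym (τ≡ i)) eq)
    where
    ρ↭ : u ++ v ↭ allFin n
    ρ↭ = subst (_↭ allFin n) e (↭-trans (rot-↭ s σ) σ↭)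
    τ≡ : ∀ i → headOr x₀ (rot i (u ++ v)) ≡ τ (s + i)
    τ≡ i = cong (headOr x₀) (trans (cong (rot i) (sym e)) (sym (rot-+ s i σ)))
    lu : length u ≡ ∣ F ∣
    lu = begin
      length u                                      ≡⟨ all⇒count (lookupᵥ F) u au ⟨
      count (lookupᵥ F) u                           ≡⟨ +-identityʳ _ ⟨
      count (lookupᵥ F) u + 0                       ≡⟨ cong (_+_ (count (lookupᵥ F) u)) (none⇒filterᵇ (lookupᵥ F) v nv) ⟨
      count (lookupᵥ F) u + count (lookupᵥ F) v     ≡⟨ count-++ (lookupᵥ F) u v ⟨
      count (lookupᵥ F) (u ++ v)                    ≡⟨ length-filterᵇ-↭ (lookupᵥ F) ρ↭ ⟩
      count (lookupᵥ F) (allFin n)                  ≡⟨ count-allFin F ⟩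
      ∣ F ∣                                         ∎
      where open ≡-Reasoning
    in-u : ∀ {x} → x ∈ˢ F → x ∈ u
    in-u {x} x∈ with ∈-++⁻ u (∈-resp-↭ (↭-sym ρ↭) (∈-allFin x))
    ... | inj₁ i = i
    ... | inj₂ i = ⊥-elim (notT (All.lookup (Allₚ.all⁺ _ v nv) i) (∈ˢ⇒T x∈))

-- Chains and antichains

⊆⇒≡⊎⊂ : ∀ {n} {p q : Subset n} → p ⊆ q → p ≡ q ⊎ p ⊂ q
⊆⇒≡⊎⊂ {p = []}        {[]}        _   = inj₁ refl
⊆⇒≡⊎⊂ {p = x ∷ p} {y ∷ q} p⊆q with ⊆⇒≡⊎⊂ (drop-∷-⊆ p⊆q)
⊆⇒≡⊎⊂ {p = true  ∷ p} {true  ∷ q} _   | inj₁ refl = inj₁ refl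
⊆⇒≡⊎⊂ {p = false ∷ p} {false ∷ q} _   | inj₁ refl = inj₁ refl
⊆⇒≡⊎⊂ {p = true  ∷ p} {false ∷ q} p⊆q | inj₁ refl with () ← p⊆q here
⊆⇒≡⊎⊂ {p = false ∷ p} {true  ∷ q} _   | inj₁ refl = inj₂ (out⊂in id)
⊆⇒≡⊎⊂ {p = true  ∷ p} {true  ∷ q} _   | inj₂ p⊂q = inj₂ (s⊂s p⊂q)
⊆⇒≡⊎⊂ {p = false ∷ p} {false ∷ q} _   | inj₂ p⊂q = inj₂ (s⊂s p⊂q)
⊆⇒≡⊎⊂ {p = true  ∷ p} {false ∷ q} p⊆q | inj₂ p⊂q with () ← p⊆q here
⊆⇒≡⊎⊂ {p = false ∷ p} {true  ∷ q} _   | inj₂ p⊂q = inj₂ (out⊂in (proj₁ p⊂q))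

module _ {n : ℕ} (𝓖 : Family n) where

  Lower Upper Isolated Top : Subset n → Set
  Lower F = Any (_⊂ F) 𝓖
  Upper F = Any (F ⊂_) 𝓖
  Isolated F = ¬ Lower F × ¬ Upper F

  -- A 3-chain with its bottom hidden in `Lower b`, so that each pair of middle and top is counted
  -- once, however many bottoms it has.
  Chain : Subset n → Subset n → Set
  Chain b c = Lower b × b ⊂ c

  Top c = Any (λ b → Chain b c) 𝓖

  lower? : Decidable Lower
  lower? F = any? (_⊂? F) 𝓖

  upper? : Decidable Upper
  upper? F = any? (F ⊂?_) 𝓖

  isolated? : Decidable Isolated
  isolated? F = ¬? (lower? F) ×-dec ¬? (upper? F)

  chain? : ∀ b c → Dec (Chain b c)
  chain? b c = lower? b ×-dec (b ⊂? c)

  top? : Decidable Top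
  top? c = any? (λ b → chain? b c) 𝓖

  -- Both the minimal members and the members that are isolated or else neither minimal nor
  -- the top of a 3-chain form antichains; isolated members occur in both.
  ∑-two-antichains : ∀ {L} (w : Subset n → ℕ) →
    (∀ {P : Subset n → Set} (P? : Decidable P) →
      (∀ {A B} → A ∈ 𝓖 → B ∈ 𝓖 → P A → P B → A ⊆ B → A ≡ B) → ∑ (filter P? 𝓖) w ≤ L) →
    ∑ 𝓖 w + ∑ 𝓖 (λ F → 𝟙 (does (isolated? F)) * w F) ≤
    2 * L + ∑ 𝓖 (λ b → ∑ 𝓖 (λ c → 𝟙 (does (chain? b c)) * w c))
  ∑-two-antichains {L} w bound = begin
    ∑ 𝓖 w + ∑ 𝓖 (λ F → 𝟙 (does (isolated? F)) * w F)      ≡⟨ ∑-distrib-+ 𝓖 w _ ⟨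
    ∑ 𝓖 (λ F → w F + 𝟙 (does (isolated? F)) * w F)        ≤⟨ ∑-mono 𝓖 pointwise ⟩
    ∑ 𝓖 (λ F → (f₁ F + f₂ F) + ∑ 𝓖 (λ b → g b F))         ≡⟨ trans (∑-distrib-+ 𝓖 _ _) (cong (_+ ∑ 𝓖 (λ F → ∑ 𝓖 (λ b → g b F))) (∑-distrib-+ 𝓖 f₁ f₂)) ⟩
    ∑ 𝓖 f₁ + ∑ 𝓖 f₂ + ∑ 𝓖 (λ F → ∑ 𝓖 (λ b → g b F))       ≡⟨ cong₂ _+_ (sym (cong₂ _+_ (∑-filter minimal? 𝓖 w) (∑-filter second? 𝓖 w))) (∑-swap 𝓖 𝓖 (λ F b → g b F)) ⟩
    ∑ (filter minimal? 𝓖) w + ∑ (filter second? 𝓖) w + ∑ 𝓖 (λ b → ∑ 𝓖 (g b))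
                                                          ≤⟨ +-monoˡ-≤ _ (+-mono-≤ (bound minimal? anti₁) (bound second? anti₂)) ⟩
    L + L + ∑ 𝓖 (λ b → ∑ 𝓖 (g b))                         ≡⟨ cong (λ k → L + k + ∑ 𝓖 (λ b → ∑ 𝓖 (g b))) (+-identityʳ L) ⟨
    2 * L + ∑ 𝓖 (λ b → ∑ 𝓖 (g b))                         ∎
    where
    open ≤-Reasoning
    Second : Subset n → Set
    Second F = Isolated F ⊎ (Lower F × ¬ Top F)
    minimal? : Decidable (λ F → ¬ Lower F)
    minimal? F = ¬? (lower? F)
    second? : Decidable Second
    second? F = isolated? F ⊎-dec (lower? F ×-dec ¬? (top? F))
    f₁ f₂ : Subset n → ℕ
    f₁ F = 𝟙 (does (minimal? F)) * w F
    f₂ F = 𝟙 (does (second? F)) * w F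
    g : Subset n → Subset n → ℕ
    g b c = 𝟙 (does (chain? b c)) * w c
    anti₁ : ∀ {A B} → A ∈ 𝓖 → B ∈ 𝓖 → ¬ Lower A → ¬ Lower B → A ⊆ B → A ≡ B
    anti₁ A∈ _ _ ¬lB A⊆B with ⊆⇒≡⊎⊂ A⊆B
    ... | inj₁ eq  = eq
    ... | inj₂ A⊂B = ⊥-elim (¬lB (lose A∈ A⊂B))
    anti₂ : ∀ {A B} → A ∈ 𝓖 → B ∈ 𝓖 → Second A → Second B → A ⊆ B → A ≡ B
    anti₂ A∈ B∈ sA sB A⊆B with ⊆⇒≡⊎⊂ A⊆B
    ... | inj₁ eq  = eq
    ... | inj₂ A⊂B with sA | sB
    ...   | inj₁ (_ , ¬uA) | _              = ⊥-elim (¬uA (lose B∈ A⊂B))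
    ...   | inj₂ _         | inj₁ (¬lB , _) = ⊥-elim (¬lB (lose A∈ A⊂B))
    -- `A` has a member below it, so it is the middle of a 3-chain with top `B`.
    ...   | inj₂ (lA , _)  | inj₂ (_ , ¬tB) = ⊥-elim (¬tB (lose A∈ (lA , A⊂B)))
    pointwise : ∀ {F} → F ∈ 𝓖 → w F + 𝟙 (does (isolated? F)) * w F ≤ (f₁ F + f₂ F) + ∑ 𝓖 (λ b → g b F)
    pointwise {F} F∈ with lower? F | upper? F | top? F
    ... | no _  | yes _ | _     = ≤-trans (+-mono-≤ (≤-reflexive (sym (+-identityʳ (w F)))) z≤n) (m≤m+n _ _)
    ... | no _  | no _  | _     = ≤-trans (+-monoˡ-≤ _ (≤-reflexive (sym (+-identityʳ (w F))))) (m≤m+n _ _)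
    ... | yes _ | _     | no _  = ≤-trans (≤-reflexive (trans (+-identityʳ (w F)) (sym (+-identityʳ (w F))))) (m≤m+n _ _)
    -- A top lies in neither antichain; a single chain ending in it pays for its weight.
    ... | yes _ | _     | yes t with b , b∈ , ch ← find t = begin
      w F + 0                         ≡⟨ cong (λ x → 𝟙 x * w F) (dec-true (chain? b F) ch) ⟨
      g b F                           ≤⟨ f≤∑ (λ b → g b F) b∈ ⟩
      ∑ 𝓖 (λ b → g b F)               ∎

-- Averaging over all cycles

-- Used with `L = n !`, where the division is exact for `1 ≤ k ≤ n`: the weight `1 / k` scaled by
-- `n !`.
reciprocal : ℕ → ℕ → ℕ
reciprocal L zero      = 0
reciprocal L k@(suc _) = L /ℕ k

does⇒ : ∀ {p} {P : Set p} (P? : Dec P) → T (does P?) → P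
does⇒ (yes p) _ = p

module Family-bound {n : ℕ} (x₀ : Fin n) (𝓕 : Family n) (u : Unique 𝓕)
  (intersecting : Intersecting 𝓕) (butterfly-free : ButterflyFree 𝓕)
  (sizes : ∀ {F} → F ∈ 𝓕 → (2 ≤ ∣ F ∣) × (2 * ∣ F ∣ ≤ n)) where

  private
    L : ℕ
    L = n !

    W : ℕ → ℕ
    W = reciprocal L

    w : Subset n → ℕ
    w F = W ∣ F ∣

    X : List (List (Fin n))
    X = arr n (allFin n)

    k*Wk : ∀ {k} → 0 < k → k ≤ n → k * W k ≡ L
    k*Wk {suc k} _ k≤n = m*[n/m]≡n (∣-trans (m∣m*n (k !)) (m≤n⇒m!∣n! k≤n))

    W-anti : ∀ {k l} → 0 < k → k ≤ l → l ≤ n → W l ≤ W k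
    W-anti {suc k} {suc l} _ k≤l _ = /-monoʳ-≤ L k≤l

    length-allFin : length (allFin n) ≡ n
    length-allFin = length-tabulate id

    isArc : Subset n → List (Fin n) → Bool
    isArc F = arc (lookupᵥ F)

    𝓖 : List (Fin n) → Family n
    𝓖 σ = filter (λ F → T? (isArc F σ)) 𝓕

    ∣F∣≤n : ∀ {F} → F ∈ 𝓕 → ∣ F ∣ ≤ n
    ∣F∣≤n {F} F∈ = ≤-trans (m≤m+n ∣ F ∣ _) (proj₂ (sizes F∈))

    0<∣F∣ : ∀ {F} → F ∈ 𝓕 → 0 < ∣ F ∣
    0<∣F∣ F∈ = ≤-trans (s≤s z≤n) (proj₁ (sizes F∈))

    size+size≤n : ∀ {F G} → F ∈ 𝓕 → G ∈ 𝓕 → ∣ F ∣ + ∣ G ∣ ≤ n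
    size+size≤n {F} {G} F∈ G∈ = *-cancelˡ-≤ 2 (begin
      2 * (∣ F ∣ + ∣ G ∣)   ≡⟨ *-distribˡ-+ 2 ∣ F ∣ ∣ G ∣ ⟩
      2 * ∣ F ∣ + 2 * ∣ G ∣ ≤⟨ +-mono-≤ (proj₂ (sizes F∈)) (proj₂ (sizes G∈)) ⟩
      n + n                 ≡⟨ cong (_+_ n) (+-identityʳ n) ⟨
      2 * n                 ∎)
      where open ≤-Reasoning

    antichain-bound : ∀ {σ} → σ ∈ X → {P : Subset n → Set} (P? : Decidable P) →
      (∀ {F G} → F ∈ 𝓖 σ → G ∈ 𝓖 σ → P F → P G → F ⊆ G → F ≡ G) → ∑ (filter P? (𝓖 σ)) w ≤ L
    antichain-bound {σ} σ∈ P? anti = ∑-clutter W (filter P? (𝓖 σ)) W-anti (λ 0<k k≤n → ≤-reflexive (k*Wk 0<k k≤n))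
      (filter⁺ P? (filter⁺ (λ F → T? (isArc F σ)) u))
      (λ F∈ → let F∈𝓖 , _ = ∈-filter⁻ P? {xs = 𝓖 σ} F∈ ; F∈𝓕 , t = ∈-filter⁻ (λ F → T? (isArc F σ)) {xs = 𝓕} F∈𝓖
              in arc⇒IsArc _ t , 0<∣F∣ F∈𝓕)
      λ {F} {G} F∈ G∈ →
        let F∈𝓖 , pF = ∈-filter⁻ P? {xs = 𝓖 σ} F∈ ; F∈𝓕 , _ = ∈-filter⁻ (λ F → T? (isArc F σ)) {xs = 𝓕} F∈𝓖
            G∈𝓖 , pG = ∈-filter⁻ P? {xs = 𝓖 σ} G∈ ; G∈𝓕 , _ = ∈-filter⁻ (λ F → T? (isArc F σ)) {xs = 𝓕} G∈𝓖
            x , x∈ = intersecting F∈𝓕 G∈𝓕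
        in record { small = size+size≤n F∈𝓕 G∈𝓕
                  ; meets = x , x∈p∩q⁻ F G x∈
                  ; ⊆⇒≡   = anti F∈𝓖 G∈𝓖 pF pG
                  ; ⊇⇒≡   = sym ∘ anti G∈𝓖 F∈𝓖 pG pF }
      where open Positions σ (∈-arr n length-allFin σ∈) x₀

    iso : List (Fin n) → Subset n → ℕ
    iso σ F = 𝟙 (does (isolated? (𝓖 σ) F))

    chain : List (Fin n) → Subset n → Subset n → ℕ
    chain σ b c = 𝟙 (does (chain? (𝓖 σ) b c))

    cycle-bound : ∀ {σ} → σ ∈ X →
      ∑ 𝓕 (λ F → 𝟙 (isArc F σ) * w F) + ∑ 𝓕 (λ F → 𝟙 (isArc F σ) * (iso σ F * w F)) ≤
      2 * L + ∑ 𝓕 (λ b → 𝟙 (isArc b σ) * ∑ 𝓕 (λ c → 𝟙 (isArc c σ) * (chain σ b c * w c)))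
    cycle-bound {σ} σ∈ = subst₂ _≤_
      (cong₂ _+_ (∑-𝓖 w) (∑-𝓖 _))
      (cong (_+_ (2 * L)) (trans (∑-𝓖 _) (∑-cong 𝓕 λ {b} _ → cong (𝟙 (isArc b σ) *_) (∑-𝓖 _))))
      (∑-two-antichains (𝓖 σ) w (antichain-bound σ∈))
      where
      ∑-𝓖 : ∀ f → ∑ (𝓖 σ) f ≡ ∑ 𝓕 (λ F → 𝟙 (isArc F σ) * f F)
      ∑-𝓖 = ∑-filter (λ F → T? (isArc F σ)) 𝓕

    ∈𝓖⁻ : ∀ σ {F} → F ∈ 𝓖 σ → F ∈ 𝓕 × T (isArc F σ)
    ∈𝓖⁻ σ = ∈-filter⁻ (λ F → T? (isArc F σ)) {xs = 𝓕}

    Lower⁻ : ∀ σ {b} → Lower (𝓖 σ) b → ∃[ a ] a ∈ 𝓕 × a ⊂ b × T (isArc a σ)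
    Lower⁻ σ l with a , a∈ , a⊂b ← find l = let a∈𝓕 , t = ∈𝓖⁻ σ a∈ in a , a∈𝓕 , a⊂b , t

    Upper⁻ : ∀ σ {b} → Upper (𝓖 σ) b → ∃[ c ] c ∈ 𝓕 × b ⊂ c × T (isArc c σ)
    Upper⁻ σ l with c , c∈ , b⊂c ← find l = let c∈𝓕 , t = ∈𝓖⁻ σ c∈ in c , c∈𝓕 , b⊂c , t

    ⊂⇒≢ : ∀ {p q : Subset n} → p ⊂ q → p ≢ q
    ⊂⇒≢ p⊂q refl = ⊂-irref refl p⊂q

    _≟ₛ_ : ∀ (p q : Subset n) → p ≡ q ⊎ p ≢ q
    p ≟ₛ q with ≡-dec _≟ᵇ_ p q
    ... | yes e = inj₁ e
    ... | no ¬e = inj₂ ¬e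

    -- Without members of `𝓕` both below and above `b` there is no chain to pay for. Otherwise
    -- butterfly-freeness leaves one `a` below and one `c` above, and `exchange` applies to these
    -- three sets.
    chains≤isolated : ∀ {b} → b ∈ 𝓕 →
      ∑[ σ ∈ X ] 𝟙 (isArc b σ) * ∑ 𝓕 (λ c → 𝟙 (isArc c σ) * (chain σ b c * w c)) ≤
      ∑[ σ ∈ X ] 𝟙 (isArc b σ) * (iso σ b * w b)
    chains≤isolated {b} b∈ with any? (_⊂? b) 𝓕 | any? (b ⊂?_) 𝓕
    ... | no ¬l | _ = ≤-trans (≤-reflexive (∑-zero X λ {σ} _ → trans (cong (𝟙 (isArc b σ) *_) (∑-zero 𝓕 λ {c} _ →
            trans (cong (λ x → 𝟙 (isArc c σ) * (x * w c)) (cong 𝟙 (dec-false (chain? (𝓖 σ) b c) λ (l , _) →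
              let a , a∈ , a⊂b , _ = Lower⁻ σ l in ¬l (lose a∈ a⊂b)))) (*-zeroʳ (𝟙 (isArc c σ))))) (*-zeroʳ (𝟙 (isArc b σ))))) z≤n
    ... | yes _ | no ¬u = ≤-trans (≤-reflexive (∑-zero X λ {σ} _ → trans (cong (𝟙 (isArc b σ) *_) (∑-zero 𝓕 λ {c} c∈ →
            trans (cong (λ x → 𝟙 (isArc c σ) * (x * w c)) (cong 𝟙 (dec-false (chain? (𝓖 σ) b c) λ (_ , b⊂c) →
              ¬u (lose c∈ b⊂c)))) (*-zeroʳ (𝟙 (isArc c σ))))) (*-zeroʳ (𝟙 (isArc b σ))))) z≤n
    ... | yes l | yes h with a , a∈ , a⊂b ← find l | c , c∈ , b⊂c ← find h = begin
      ∑[ σ ∈ X ] 𝟙 (isArc b σ) * ∑ 𝓕 (λ c → 𝟙 (isArc c σ) * (chain σ b c * w c))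
        ≤⟨ ∑-mono X (λ {σ} _ → *-monoʳ-≤ (𝟙 (isArc b σ)) (chains≤both σ)) ⟩
      ∑[ σ ∈ X ] 𝟙 (isArc b σ) * (both σ * w c)
        ≡⟨ trans (∑-cong X λ {σ} _ → sym (*-assoc (𝟙 (isArc b σ)) (both σ) (w c))) (*-distribʳ-∑ (w c) X _) ⟩
      S₁ * w c
        -- Multiplication by `m * k` turns both weights into `L`, and what remains is `exchange`.
        ≤⟨ *-cancelˡ-≤ (m * k) {{m*n≢0 m k {{>-nonZero (0<∣F∣ b∈)}} {{>-nonZero (0<∣F∣ c∈)}}}} (begin
             m * k * (S₁ * w c)  ≡⟨ solve 4 (λ m k s w → m :* k :* (s :* w) := m :* s :* (k :* w)) refl m k S₁ (w c) ⟩
             m * S₁ * (k * w c)  ≡⟨ cong (m * S₁ *_) (k*Wk (0<∣F∣ c∈) (∣F∣≤n c∈)) ⟩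
             m * S₁ * L          ≤⟨ *-monoˡ-≤ L S₁≤S₂ ⟩
             k * S₂ * L          ≡⟨ cong (k * S₂ *_) (k*Wk (0<∣F∣ b∈) (∣F∣≤n b∈)) ⟨
             k * S₂ * (m * w b)  ≡⟨ solve 4 (λ m k s w → k :* s :* (m :* w) := m :* k :* (s :* w)) refl m k S₂ (w b) ⟩
             m * k * (S₂ * w b)  ∎) ⟩
      S₂ * w b
        ≡⟨ trans (∑-cong X λ {σ} _ → sym (*-assoc (𝟙 (isArc b σ)) (neither σ) (w b))) (*-distribʳ-∑ (w b) X _) ⟨
      ∑[ σ ∈ X ] 𝟙 (isArc b σ) * (neither σ * w b)
        ≤⟨ ∑-mono X (λ {σ} _ → *-monoʳ-≤ (𝟙 (isArc b σ)) (*-monoˡ-≤ (w b) (neither≤iso σ))) ⟩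
      ∑[ σ ∈ X ] 𝟙 (isArc b σ) * (iso σ b * w b) ∎
      where
      open ≤-Reasoning
      open +-*-Solver
      m k : ℕ
      m = ∣ b ∣
      k = ∣ c ∣
      ⊂⇒T : ∀ {p q : Subset n} → p ⊂ q → ∀ x → T (lookupᵥ p x) → T (lookupᵥ q x)
      ⊂⇒T p⊂q x t = ∈ˢ⇒T (proj₁ p⊂q (T⇒∈ˢ t))
      count≡ : ∀ F → ∣ F ∣ ≡ count (lookupᵥ F) (allFin n)
      count≡ F = sym (count-allFin F)
      open Exchange (allFin n) (lookupᵥ a) (lookupᵥ b) (lookupᵥ c) (⊂⇒T a⊂b) (⊂⇒T b⊂c)
        (subst (2 ≤_) (count≡ a) (proj₁ (sizes a∈)))
        (subst₂ _<_ (count≡ a) (count≡ b) (p⊂q⇒∣p∣<∣q∣ a⊂b))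
        (subst₂ _<_ (count≡ b) (count≡ c) (p⊂q⇒∣p∣<∣q∣ b⊂c))
        (subst₂ (λ k n → 2 * k ≤ n) (count≡ c) (sym length-allFin) (proj₂ (sizes c∈)))
      S₁ S₂ : ℕ
      S₁ = ∑[ σ ∈ X ] 𝟙 (isArc b σ) * both σ
      S₂ = ∑[ σ ∈ X ] 𝟙 (isArc b σ) * neither σ
      S₁≤S₂ : m * S₁ ≤ k * S₂
      S₁≤S₂ = subst₂ (λ m k → m * S₁ ≤ k * S₂) (count-allFin b) (count-allFin c)
        (subst (λ l → count (lookupᵥ b) (allFin n) * (∑[ σ ∈ arr l (allFin n) ] 𝟙 (isArc b σ) * both σ) ≤
                      count (lookupᵥ c) (allFin n) * (∑[ σ ∈ arr l (allFin n) ] 𝟙 (isArc b σ) * neither σ)) length-allFin exchange)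
      -- A second `a′` would make a butterfly with `a′`, `a` below `b`, `c`.
      a-unique : ∀ {a′} → a′ ∈ 𝓕 → a′ ⊂ b → a′ ≡ a
      a-unique {a′} a′∈ a′⊂b with a′ ≟ₛ a
      ... | inj₁ e = e
      ... | inj₂ a′≢a = ⊥-elim (butterfly-free a′∈ a∈ b∈ c∈ a′≢a (⊂⇒≢ a′⊂b) (⊂⇒≢ (⊂-trans a′⊂b b⊂c)) (⊂⇒≢ a⊂b)
              (⊂⇒≢ (⊂-trans a⊂b b⊂c)) (⊂⇒≢ b⊂c)
              ((proj₁ a′⊂b , proj₁ a⊂b) , (proj₁ (⊂-trans a′⊂b b⊂c) , proj₁ (⊂-trans a⊂b b⊂c))))
      -- A second `c′` would make a butterfly with `a`, `b` below `c′`, `c`.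
      c-unique : ∀ {c′} → c′ ∈ 𝓕 → b ⊂ c′ → c′ ≡ c
      c-unique {c′} c′∈ b⊂c′ with c′ ≟ₛ c
      ... | inj₁ e = e
      ... | inj₂ c′≢c = ⊥-elim (butterfly-free a∈ b∈ c′∈ c∈ (⊂⇒≢ a⊂b) (⊂⇒≢ (⊂-trans a⊂b b⊂c′)) (⊂⇒≢ (⊂-trans a⊂b b⊂c))
              (⊂⇒≢ b⊂c′) (⊂⇒≢ b⊂c) c′≢c
              ((proj₁ (⊂-trans a⊂b b⊂c′) , proj₁ b⊂c′) , (proj₁ (⊂-trans a⊂b b⊂c) , proj₁ b⊂c)))
      chains≤both : ∀ σ → ∑ 𝓕 (λ c → 𝟙 (isArc c σ) * (chain σ b c * w c)) ≤ both σ * w c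
      chains≤both σ = ≤-trans
        (∑-concentrated c u
          (λ {c′} c′∈ c′≢c → trans (cong (λ x → 𝟙 (isArc c′ σ) * (x * w c′)) (cong 𝟙 (dec-false (chain? (𝓖 σ) b c′) λ (_ , b⊂c′) →
              c′≢c (c-unique c′∈ b⊂c′)))) (*-zeroʳ (𝟙 (isArc c′ σ))))
          (λ {c′} _ → c′ ≟ₛ c))
        (begin
          𝟙 (isArc c σ) * (chain σ b c * w c)   ≤⟨ *-monoʳ-≤ (𝟙 (isArc c σ)) (*-monoˡ-≤ (w c) (𝟙-mono chain⇒a)) ⟩
          𝟙 (isArc c σ) * (𝟙 (isArc a σ) * w c)     ≡⟨ solve 3 (λ x y z → x :* (y :* z) := y :* x :* z) refl (𝟙 (isArc c σ)) (𝟙 (isArc a σ)) (w c) ⟩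
          both σ * w c                      ∎)
        where
        chain⇒a : T (does (chain? (𝓖 σ) b c)) → T (isArc a σ)
        chain⇒a t with a′ , a′∈ , a′⊂b , t′ ← Lower⁻ σ (proj₁ (does⇒ (chain? (𝓖 σ) b c) t)) =
          subst (λ a → T (isArc a σ)) (a-unique a′∈ a′⊂b) t′
      neither≤iso : ∀ σ → neither σ ≤ iso σ b
      neither≤iso σ with isArc a σ in eqa | isArc c σ in eqc
      ... | true  | _     = z≤n
      ... | false | true  = z≤n
      ... | false | false = ≤-reflexive (cong 𝟙 (sym (dec-true (isolated? (𝓖 σ) b)
                ((λ l → let a′ , a′∈ , a′⊂b , t = Lower⁻ σ l in subst T (trans (cong (λ a → isArc a σ) (a-unique a′∈ a′⊂b)) eqa) t) ,
                 (λ h → let c′ , c′∈ , b⊂c′ , t = Upper⁻ σ h in subst T (trans (cong (λ c → isArc c σ) (c-unique c′∈ b⊂c′)) eqc) t)))))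

    -- The total `I` of the members covered twice stands on the left in `cycle-bound`, and bounds
    -- the contribution of the 3-chains on the right by `chains≤isolated`; so it cancels.
    ∑∑w≤ : ∑ 𝓕 (λ F → ∑ X (λ σ → 𝟙 (isArc F σ) * w F)) ≤ n ! * (2 * L)
    ∑∑w≤ = +-cancelʳ-≤ I _ _ (begin
      ∑ 𝓕 (λ F → ∑ X (λ σ → 𝟙 (isArc F σ) * w F)) + I
        ≡⟨ cong₂ _+_ (∑-swap X 𝓕 _) (∑-swap X 𝓕 _) ⟨
      ∑ X (λ σ → ∑ 𝓕 (λ F → 𝟙 (isArc F σ) * w F)) + ∑ X (λ σ → ∑ 𝓕 (λ F → 𝟙 (isArc F σ) * (iso σ F * w F)))
        ≡⟨ ∑-distrib-+ X _ _ ⟨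
      ∑ X (λ σ → ∑ 𝓕 (λ F → 𝟙 (isArc F σ) * w F) + ∑ 𝓕 (λ F → 𝟙 (isArc F σ) * (iso σ F * w F)))
        ≤⟨ ∑-mono X cycle-bound ⟩
      ∑ X (λ σ → 2 * L + ∑ 𝓕 (λ b → 𝟙 (isArc b σ) * ∑ 𝓕 (λ c → 𝟙 (isArc c σ) * (chain σ b c * w c))))
        ≡⟨ ∑-distrib-+ X _ _ ⟩
      ∑ X (λ _ → 2 * L) + ∑ X (λ σ → ∑ 𝓕 (λ b → 𝟙 (isArc b σ) * ∑ 𝓕 (λ c → 𝟙 (isArc c σ) * (chain σ b c * w c))))
        ≡⟨ cong₂ _+_ (trans (∑-const X (2 * L)) (cong (_* (2 * L)) ∣X∣)) (∑-swap X 𝓕 _) ⟩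
      n ! * (2 * L) + ∑ 𝓕 (λ b → ∑ X (λ σ → 𝟙 (isArc b σ) * ∑ 𝓕 (λ c → 𝟙 (isArc c σ) * (chain σ b c * w c))))
        ≤⟨ +-monoʳ-≤ (n ! * (2 * L)) (∑-mono 𝓕 chains≤isolated) ⟩
      n ! * (2 * L) + I ∎)
      where
      open ≤-Reasoning
      I : ℕ
      I = ∑ 𝓕 (λ F → ∑ X (λ σ → 𝟙 (isArc F σ) * (iso σ F * w F)))
      ∣X∣ : length X ≡ n !
      ∣X∣ = subst (λ l → length (arr l (allFin n)) ≡ l !) length-allFin (length-arr (allFin n))

    ∑-arc-w : ∀ {F} → F ∈ 𝓕 → ∑ X (λ σ → 𝟙 (isArc F σ) * w F) ≡ n * L * ((∣ F ∣ ∸ 1) ! * (n ∸ ∣ F ∣) !)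
    ∑-arc-w {F} F∈ with ∣ F ∣ in eq | 0<∣F∣ F∈ | ∣F∣≤n F∈ | proj₁ (sizes F∈) | proj₂ (sizes F∈)
    ... | k@(suc k₀) | 0<k | k≤n | 2≤k | 2k≤n = begin
      ∑ X (λ σ → 𝟙 (isArc F σ) * W k)                      ≡⟨ *-distribʳ-∑ (W k) X (λ σ → 𝟙 (isArc F σ)) ⟩
      ∑ X (𝟙 ∘ isArc F) * W k                              ≡⟨ cong (_* W k) (∑-cong X λ _ → sym (*-identityʳ _)) ⟩
      ∑ X (λ σ → 𝟙 (isArc F σ) * 1) * W k                  ≡⟨ cong (_* W k) (∑-arr-arc (lookupᵥ F) (allFin n) length-allFin
                                                            (subst (0 <_) (sym ck) 0<k) (subst (_< n) (sym ck) k<n) (λ _ → 1) (λ _ → refl)) ⟩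
      n * ∑ X (λ σ → 𝟙 (sorted (lookupᵥ F) σ) * 1) * W k ≡⟨ cong (λ s → n * s * W k) (trans (∑-cong X λ _ → *-identityʳ _) sortedX) ⟩
      n * (k ! * (n ∸ k) !) * W k                      ≡⟨ solve 5 (λ n k f g w → n :* ((k :* f) :* g) :* w := n :* (k :* w) :* (f :* g)) refl n k (k₀ !) ((n ∸ k) !) (W k) ⟩
      n * (k * W k) * (k₀ ! * (n ∸ k) !)               ≡⟨ cong (λ l → n * l * (k₀ ! * (n ∸ k) !)) (k*Wk 0<k k≤n) ⟩
      n * L * (k₀ ! * (n ∸ k) !)                       ∎
      where
      open ≡-Reasoning
      open +-*-Solver
      k<n : k < n
      k<n = <-≤-trans (m<m+n k (subst (0 <_) (sym (+-identityʳ k)) 0<k)) 2k≤n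
      ck : count (lookupᵥ F) (allFin n) ≡ k
      ck = trans (count-allFin F) eq
      sortedX : ∑ X (𝟙 ∘ sorted (lookupᵥ F)) ≡ k ! * (n ∸ k) !
      sortedX = subst (λ l → ∑ (arr l (allFin n)) (𝟙 ∘ sorted (lookupᵥ F)) ≡ k ! * (n ∸ k) !) (m+[n∸m]≡n k≤n)
        (∑-arr-𝟙-sorted (lookupᵥ F) (allFin n) ck
          (sym (trans (cong₂ _∸_ (sym (trans (length-filterᵇ+ (lookupᵥ F) (allFin n)) length-allFin)) (sym ck)) (m+n∸m≡n (count (lookupᵥ F) (allFin n)) _))))

  -- The theorem multiplied by `(n - 1) !`.
  ∑-factorials≤ : ∑[ F ∈ 𝓕 ] ((∣ F ∣ ∸ 1) ! * (n ∸ ∣ F ∣) !) ≤ 2 * (n ∸ 1) !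
  ∑-factorials≤ = *-cancelˡ-≤ (n * L) {{m*n≢0 n L {{n≢0}} {{n !≢0}}}} (begin
    n * L * ∑ 𝓕 f                              ≡⟨ *-distribˡ-∑ (n * L) 𝓕 f ⟨
    ∑ 𝓕 (λ F → n * L * f F)                    ≡⟨ ∑-cong 𝓕 ∑-arc-w ⟨
    ∑ 𝓕 (λ F → ∑ X (λ σ → 𝟙 (isArc F σ) * w F))    ≤⟨ ∑∑w≤ ⟩
    n ! * (2 * L)                              ≡⟨ cong (_* (2 * L)) n!≡ ⟩
    n * (n ∸ 1) ! * (2 * L)                    ≡⟨ solve 3 (λ n f l → n :* f :* (con 2 :* l) := n :* l :* (con 2 :* f)) refl n ((n ∸ 1) !) L ⟩
    n * L * (2 * (n ∸ 1) !)                    ∎)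
    where
    open ≤-Reasoning
    open +-*-Solver
    f : Subset n → ℕ
    f F = (∣ F ∣ ∸ 1) ! * (n ∸ ∣ F ∣) !
    n≢0 : NonZero n
    n≢0 = nonZeroIndex x₀
    n!≡ : n ! ≡ n * (n ∸ 1) !
    n!≡ = go x₀
      where go : ∀ {m} → Fin m → m ! ≡ m * (m ∸ 1) !
            go {suc m} _ = refl

-- From factorials to rational weights

nCk*k!*[n∸k]!≡n! : ∀ {n k} → k ≤ n → (n C k) * (k ! * (n ∸ k) !) ≡ n !
nCk*k!*[n∸k]!≡n! {n} {k} k≤n = trans (cong (_* (k ! * (n ∸ k) !)) (nCk≡n!/k![n-k]! k≤n)) (m/n*n≡m {{k !* (n ∸ k) !≢0}} (k![n∸k]!∣n! k≤n))

toℚᵘ-recip : ∀ c v {d} → c * v ≡ suc d → ℚ.toℚᵘ (recip c) ℚᵘ.≃ mkℚᵘ (+ v) d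
toℚᵘ-recip (suc c) v {d} eq = ℚᵘ.≃-trans (ℚ.toℚᵘ-fromℚᵘ (mkℚᵘ (+ 1) c)) (*≡* (begin
  + 1 ℤ.* + suc d   ≡⟨ ℤ.*-identityˡ (+ suc d) ⟩
  + suc d           ≡⟨ cong +_ (trans (sym eq) (*-comm (suc c) v)) ⟩
  + (v * suc c)     ≡⟨ ℤ.pos-* v (suc c) ⟩
  + v ℤ.* + suc c   ∎))
  where open ≡-Reasoning

mkℚᵘ-+ : ∀ a b d → mkℚᵘ (+ a) d ℚᵘ.+ mkℚᵘ (+ b) d ℚᵘ.≃ mkℚᵘ (+ (a + b)) d
mkℚᵘ-+ a b d = *≡* (begin
  (+ a ℤ.* D ℤ.+ + b ℤ.* D) ℤ.* D ≡⟨ cong (ℤ._* D) (ℤ.*-distribʳ-+ D (+ a) (+ b)) ⟨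
  (+ a ℤ.+ + b) ℤ.* D ℤ.* D       ≡⟨ ℤ.*-assoc (+ (a + b)) D D ⟩
  + (a + b) ℤ.* (D ℤ.* D)         ≡⟨ cong (+ (a + b) ℤ.*_) (ℤ.pos-* (suc d) (suc d)) ⟨
  + (a + b) ℤ.* + (suc d * suc d) ∎)
  where
  open ≡-Reasoning
  D = + suc d

-- Unnormalised rationals allow one denominator, `suc d = (n - 1) !` in the application, for all
-- weights, so that adding them only adds the numerators `v F`.
toℚᵘ-weightSum : ∀ {n d} (𝓕 : Family n) (v : Subset n → ℕ) →
  (∀ {F} → F ∈ 𝓕 → ((n ∸ 1) C (∣ F ∣ ∸ 1)) * v F ≡ suc d) → ℚ.toℚᵘ (weightSum 𝓕) ℚᵘ.≃ mkℚᵘ (+ ∑ 𝓕 v) d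
toℚᵘ-weightSum []      v h = *≡* refl
toℚᵘ-weightSum {n} {d} (F ∷ 𝓕) v h = ℚᵘ.≃-trans (ℚ.toℚᵘ-homo-+ (weight F) (weightSum 𝓕))
  (ℚᵘ.≃-trans (ℚᵘ.+-cong (toℚᵘ-recip ((n ∸ 1) C (∣ F ∣ ∸ 1)) (v F) (h (here refl))) (toℚᵘ-weightSum 𝓕 v (h ∘ there)))
              (mkℚᵘ-+ (v F) (∑ 𝓕 v) d))

weightSum≤2 : ∀ {n} (𝓕 : Family n) (v : Subset n → ℕ) d →
  (∀ {F} → F ∈ 𝓕 → ((n ∸ 1) C (∣ F ∣ ∸ 1)) * v F ≡ d) → 0 < d → ∑ 𝓕 v ≤ 2 * d → weightSum 𝓕 ℚ.≤ + 2 / 1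
weightSum≤2 𝓕 v (suc d) h _ le = ℚ.toℚᵘ-cancel-≤ (ℚᵘ.≤-respˡ-≃ (ℚᵘ.≃-sym (toℚᵘ-weightSum 𝓕 v h)) (*≤* (begin
  + ∑ 𝓕 v ℤ.* + 1   ≡⟨ ℤ.*-identityʳ (+ ∑ 𝓕 v) ⟩
  + ∑ 𝓕 v           ≤⟨ ℤ.+≤+ le ⟩
  + (2 * suc d)     ≡⟨ ℤ.pos-* 2 (suc d) ⟩
  + 2 ℤ.* + suc d   ∎)))
  where open ℤ.≤-Reasoning

theorem11 : (n : ℕ) (𝓕 : Family n) → Unique 𝓕 →
    Intersecting 𝓕 → ButterflyFree 𝓕 →
    (∀ {F} → F ∈ 𝓕 → (2 ≤ℕ ∣ F ∣) × (2 * ∣ F ∣ ≤ℕ n)) →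
    weightSum 𝓕 ≤ℚ (+ 2 / 1)
theorem11 n 𝓕@[] _ _ _ _ = ℚ.*≤* (ℤ.+≤+ z≤n)
-- `F₀` meets itself, which provides the element of `Fin n` that `Family-bound` asks for.
theorem11 n 𝓕@(F₀ ∷ _) u int bf sizes = weightSum≤2 𝓕 (λ F → (∣ F ∣ ∸ 1) ! * (n ∸ ∣ F ∣) !) ((n ∸ 1) !) eq (1≤n! (n ∸ 1)) (∑-factorials≤ (proj₁ (int (here refl) (here refl))) 𝓕 u int bf sizes)
  where
  open Family-bound
  eq : ∀ {F} → F ∈ 𝓕 → ((n ∸ 1) C (∣ F ∣ ∸ 1)) * ((∣ F ∣ ∸ 1) ! * (n ∸ ∣ F ∣) !) ≡ (n ∸ 1) !
  eq {F} F∈ with sizes F∈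
  ... | 2≤F , 2F≤n = trans (cong (λ l → ((n ∸ 1) C (∣ F ∣ ∸ 1)) * ((∣ F ∣ ∸ 1) ! * l !)) (sym n∸k))
    (nCk*k!*[n∸k]!≡n! (∸-monoˡ-≤ 1 (≤-trans (m≤m+n ∣ F ∣ _) 2F≤n)))
    where
    n∸k : n ∸ 1 ∸ (∣ F ∣ ∸ 1) ≡ n ∸ ∣ F ∣
    n∸k = trans (∸-+-assoc n 1 (∣ F ∣ ∸ 1)) (cong (n ∸_) (m+[n∸m]≡n (≤-trans (s≤s z≤n) 2≤F)))
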